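{- For each $n\ge 0$ write the rational number $c_n$ as $c_n=\dfrac{p_n}{q_n}$ with integers $p_n,q_n$, $q_n>0$ and $(p_n,q_n)=1$. Then $$q_n=2^{2n-b(n)}r_n,$$ where $r_n$ is odd and $b(n)$ is the number of non-zero digits in the binary expansion of $n$. In other words, the 2-adic norm of $c_n$ equals $|c_n|_2=2^{2n-b(n)}$. In particular, $c_n\ne 0$ for all $n\ge 0$.
   Context: $|\cdot|_2$ is the 2-adic norm on $\mathbb Q$ normalized by $|2|_2=1/2$. Let $\mathcal H=L^2([0,1],dx)$ (complex-valued functions, Lebesgue measure) with its norm $\|\cdot\|$. The sequence $(c_n)_{n\ge 0}$ is defined recursively: $c_0=1$, and, for each $n\ge 0$, the number $c_{n+1}$ is the unique complex number $c$ for which the norm $\|c_0+c_1x+\ldots+c_nx^n+c\,x^{n+1}\|$ is minimal among all $c\in\mathbb C$. Equivalently, $c_0=1$ and $\frac{c_0}{n+1}+\frac{c_1}{n+2}+\ldots+\frac{c_n}{2n+1}=0$ for all $n\ge 1$; in particular all $c_n$ are rational. -}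

module Defs where

open import Algebra.Bundles using (RawRing)
import Algebra.Definitions.RawSemiring as RawSemiringDefinitions
open import Data.Bool using (if_then_else_)
open import Data.Digit using (toDigits; 0b)
open import Data.Fin using (toℕ)
import Data.Fin.Properties as Fin
open import Data.Integer as ℤ using (+_)
open import Data.List using (length; filter; foldr; upTo)
open import Data.Nat as ℕ using (ℕ; suc; _⊔_)
import Data.Nat.Properties as ℕ
open import Data.Nat.Divisibility using (_∣?_)
open import Data.Product using (∃; _×_; _,_; proj₁)
open import Data.Rational as ℚ using (ℚ; 0ℚ; 1ℚ; ½; ↥_; ↧ₙ_)
import Data.Rational.Properties as ℚ
open import Data.Rational.Solver using (module +-*-Solver)
open import Function using (_∘_)
open import Level using (0ℓ)
open import Relation.Binary.PropositionalEquality
  using (_≡_; refl; sym; trans; cong; subst)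
open import Relation.Nullary using (¬?; does)

-- Real numbers: Cauchy sequences of rationals, with the setoid equality
-- "the difference tends to 0".

Cauchy : (ℕ → ℚ) → Set
Cauchy x = ∀ ε → 0ℚ ℚ.< ε →
  ∃ λ N → ∀ m n → N ℕ.≤ m → N ℕ.≤ n → ℚ.∣ x m ℚ.- x n ∣ ℚ.≤ ε

record ℝ : Set where
  constructor real
  field
    seq    : ℕ → ℚ
    cauchy : Cauchy seq

open ℝ public

private
  halve : ∀ {ε} → 0ℚ ℚ.< ε → 0ℚ ℚ.< ½ ℚ.* ε
  halve {ε} 0<ε = ℚ.*-monoʳ-<-pos ½ 0<ε

  halves : ∀ ε → ½ ℚ.* ε ℚ.+ ½ ℚ.* ε ≡ ε
  halves ε = trans (sym (ℚ.*-distribʳ-+ ε ½ ½)) (ℚ.*-identityˡ ε)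

  -- a bound valid from some index on, for the Cauchyness of products
  bound : (x : ℝ) → ∃ λ B → ∃ λ N →
          ℚ.Positive B × (∀ n → N ℕ.≤ n → ℚ.∣ seq x n ∣ ℚ.≤ B)
  bound x with cauchy x 1ℚ (ℚ.positive⁻¹ 1ℚ)
  ... | N , close = B , N , B-pos , below
    where
    B : ℚ
    B = 1ℚ ℚ.+ ℚ.∣ seq x N ∣

    B-pos : ℚ.Positive B
    B-pos = ℚ.positive (ℚ.+-mono-<-≤ (ℚ.positive⁻¹ 1ℚ) (ℚ.0≤∣p∣ (seq x N)))

    below : ∀ n → N ℕ.≤ n → ℚ.∣ seq x n ∣ ℚ.≤ B
    below n N≤n = begin
      ℚ.∣ seq x n ∣
        ≡⟨ cong ℚ.∣_∣ (split (seq x n) (seq x N)) ⟩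
      ℚ.∣ (seq x n ℚ.- seq x N) ℚ.+ seq x N ∣
        ≤⟨ ℚ.∣p+q∣≤∣p∣+∣q∣ (seq x n ℚ.- seq x N) (seq x N) ⟩
      ℚ.∣ seq x n ℚ.- seq x N ∣ ℚ.+ ℚ.∣ seq x N ∣
        ≤⟨ ℚ.+-monoˡ-≤ ℚ.∣ seq x N ∣ (close n N N≤n ℕ.≤-refl) ⟩
      B ∎
      where
      open ℚ.≤-Reasoning
      split : ∀ a b → a ≡ (a ℚ.- b) ℚ.+ b
      split = solve 2 (λ a b → a := (a :- b) :+ b) refl
        where open +-*-Solver

  cauchy-const : ∀ q → Cauchy (λ _ → q)
  cauchy-const q ε 0<ε = 0 , λ _ _ _ _ →
    subst (λ d → ℚ.∣ d ∣ ℚ.≤ ε) (sym (ℚ.+-inverseʳ q)) (ℚ.<⇒≤ 0<ε)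

  cauchy-+ : ∀ (x y : ℝ) → Cauchy (λ n → seq x n ℚ.+ seq y n)
  cauchy-+ x y ε 0<ε
    with cauchy x (½ ℚ.* ε) (halve 0<ε) | cauchy y (½ ℚ.* ε) (halve 0<ε)
  ... | M , closeˣ | N , closeʸ = M ⊔ N , λ m n m≥ n≥ → begin
      ℚ.∣ (seq x m ℚ.+ seq y m) ℚ.- (seq x n ℚ.+ seq y n) ∣
        ≡⟨ cong ℚ.∣_∣ (regroup (seq x m) (seq y m) (seq x n) (seq y n)) ⟩
      ℚ.∣ (seq x m ℚ.- seq x n) ℚ.+ (seq y m ℚ.- seq y n) ∣
        ≤⟨ ℚ.∣p+q∣≤∣p∣+∣q∣ (seq x m ℚ.- seq x n) (seq y m ℚ.- seq y n) ⟩
      ℚ.∣ seq x m ℚ.- seq x n ∣ ℚ.+ ℚ.∣ seq y m ℚ.- seq y n ∣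
        ≤⟨ ℚ.+-mono-≤
             (closeˣ m n (ℕ.m⊔n≤o⇒m≤o M N m≥) (ℕ.m⊔n≤o⇒m≤o M N n≥))
             (closeʸ m n (ℕ.m⊔n≤o⇒n≤o M N m≥) (ℕ.m⊔n≤o⇒n≤o M N n≥)) ⟩
      ½ ℚ.* ε ℚ.+ ½ ℚ.* ε
        ≡⟨ halves ε ⟩
      ε ∎
    where
    open ℚ.≤-Reasoning
    regroup : ∀ a b c d → (a ℚ.+ b) ℚ.- (c ℚ.+ d) ≡ (a ℚ.- c) ℚ.+ (b ℚ.- d)
    regroup = solve 4 (λ a b c d →
      (a :+ b) :- (c :+ d) := (a :- c) :+ (b :- d)) refl
      where open +-*-Solver

  cauchy-neg : ∀ (x : ℝ) → Cauchy (λ n → ℚ.- seq x n)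
  cauchy-neg x ε 0<ε with cauchy x ε 0<ε
  ... | N , close = N , λ m n m≥ n≥ → begin
      ℚ.∣ (ℚ.- seq x m) ℚ.- (ℚ.- seq x n) ∣
        ≡⟨ cong ℚ.∣_∣ (flip (seq x m) (seq x n)) ⟩
      ℚ.∣ seq x n ℚ.- seq x m ∣
        ≤⟨ close n m n≥ m≥ ⟩
      ε ∎
    where
    open ℚ.≤-Reasoning
    flip : ∀ a b → (ℚ.- a) ℚ.- (ℚ.- b) ≡ b ℚ.- a
    flip = solve 2 (λ a b → (:- a) :- (:- b) := b :- a) refl
      where open +-*-Solver

  share : ∀ B C ε → ℚ.Positive B → ℚ.Positive C → 0ℚ ℚ.< ε →
          ∃ λ δ → 0ℚ ℚ.< δ × B ℚ.* δ ℚ.+ C ℚ.* δ ≡ ε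
  share B C ε B-pos C-pos 0<ε = δ , ℚ.positive⁻¹ δ {{δ-pos}} , sums-to-ε
    where
    instance
      B+C-pos : ℚ.Positive (B ℚ.+ C)
      B+C-pos = ℚ.pos+pos⇒pos B {{B-pos}} C {{C-pos}}

      B+C≢0 : ℚ.NonZero (B ℚ.+ C)
      B+C≢0 = ℚ.pos⇒nonZero (B ℚ.+ C)

    δ : ℚ
    δ = ℚ.1/ (B ℚ.+ C) ℚ.* ε

    δ-pos : ℚ.Positive δ
    δ-pos = ℚ.pos*pos⇒pos (ℚ.1/ (B ℚ.+ C)) {{ℚ.1/pos⇒pos (B ℚ.+ C)}}
                          ε {{ℚ.positive 0<ε}}

    sums-to-ε : B ℚ.* δ ℚ.+ C ℚ.* δ ≡ ε
    sums-to-ε =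
      trans (sym (ℚ.*-distribʳ-+ δ B C))
        (trans (sym (ℚ.*-assoc (B ℚ.+ C) (ℚ.1/ (B ℚ.+ C)) ε))
          (trans (cong (ℚ._* ε) (ℚ.*-inverseʳ (B ℚ.+ C))) (ℚ.*-identityˡ ε)))

  ∣*∣-≤ : ∀ {a b} A δ → ℚ.Positive A →
          ℚ.∣ a ∣ ℚ.≤ A → ℚ.∣ b ∣ ℚ.≤ δ → ℚ.∣ a ℚ.* b ∣ ℚ.≤ A ℚ.* δ
  ∣*∣-≤ {a} {b} A δ A-pos ∣a∣≤A ∣b∣≤δ = begin
    ℚ.∣ a ℚ.* b ∣
      ≡⟨ ℚ.∣p*q∣≡∣p∣*∣q∣ a b ⟩
    ℚ.∣ a ∣ ℚ.* ℚ.∣ b ∣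
      ≤⟨ ℚ.*-monoʳ-≤-nonNeg ℚ.∣ b ∣ {{ℚ.nonNegative (ℚ.0≤∣p∣ b)}} ∣a∣≤A ⟩
    A ℚ.* ℚ.∣ b ∣
      ≤⟨ ℚ.*-monoˡ-≤-nonNeg A {{ℚ.pos⇒nonNeg A {{A-pos}}}} ∣b∣≤δ ⟩
    A ℚ.* δ ∎
    where open ℚ.≤-Reasoning

  product-difference : ∀ a b c d →
    a ℚ.* b ℚ.- c ℚ.* d ≡ a ℚ.* (b ℚ.- d) ℚ.+ d ℚ.* (a ℚ.- c)
  product-difference = solve 4 (λ a b c d →
    a :* b :- c :* d := a :* (b :- d) :+ d :* (a :- c)) refl
    where open +-*-Solver

  cauchy-* : ∀ (x y : ℝ) → Cauchy (λ n → seq x n ℚ.* seq y n)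
  cauchy-* x y ε 0<ε =
    let B , Nᴮ , B-pos , ∣x∣≤B = bound x
        C , Nᶜ , C-pos , ∣y∣≤C = bound y
        δ , 0<δ , sums-to-ε    = share B C ε B-pos C-pos 0<ε
        M , closeˣ             = cauchy x δ 0<δ
        N , closeʸ             = cauchy y δ 0<δ
    in  (Nᴮ ⊔ Nᶜ) ⊔ (M ⊔ N) , λ m n m≥ n≥ →
        let m≥₁ = ℕ.m⊔n≤o⇒m≤o (Nᴮ ⊔ Nᶜ) (M ⊔ N) m≥
            m≥₂ = ℕ.m⊔n≤o⇒n≤o (Nᴮ ⊔ Nᶜ) (M ⊔ N) m≥
            n≥₁ = ℕ.m⊔n≤o⇒m≤o (Nᴮ ⊔ Nᶜ) (M ⊔ N) n≥
            n≥₂ = ℕ.m⊔n≤o⇒n≤o (Nᴮ ⊔ Nᶜ) (M ⊔ N) n≥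
        in  estimate B C δ B-pos C-pos sums-to-ε (seq x m) (seq y m) (seq x n) (seq y n)
              (∣x∣≤B m (ℕ.m⊔n≤o⇒m≤o Nᴮ Nᶜ m≥₁))
              (∣y∣≤C n (ℕ.m⊔n≤o⇒n≤o Nᴮ Nᶜ n≥₁))
              (closeˣ m n (ℕ.m⊔n≤o⇒m≤o M N m≥₂) (ℕ.m⊔n≤o⇒m≤o M N n≥₂))
              (closeʸ m n (ℕ.m⊔n≤o⇒n≤o M N m≥₂) (ℕ.m⊔n≤o⇒n≤o M N n≥₂))
    where
    open ℚ.≤-Reasoning
    estimate : ∀ B C δ → ℚ.Positive B → ℚ.Positive C →
      B ℚ.* δ ℚ.+ C ℚ.* δ ≡ ε → ∀ a b c d →
      ℚ.∣ a ∣ ℚ.≤ B → ℚ.∣ d ∣ ℚ.≤ C →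
      ℚ.∣ a ℚ.- c ∣ ℚ.≤ δ → ℚ.∣ b ℚ.- d ∣ ℚ.≤ δ →
      ℚ.∣ a ℚ.* b ℚ.- c ℚ.* d ∣ ℚ.≤ ε
    estimate B C δ B-pos C-pos sums-to-ε a b c d ∣a∣≤B ∣d∣≤C ∣a-c∣≤δ ∣b-d∣≤δ = begin
      ℚ.∣ a ℚ.* b ℚ.- c ℚ.* d ∣
        ≡⟨ cong ℚ.∣_∣ (product-difference a b c d) ⟩
      ℚ.∣ a ℚ.* (b ℚ.- d) ℚ.+ d ℚ.* (a ℚ.- c) ∣
        ≤⟨ ℚ.∣p+q∣≤∣p∣+∣q∣ (a ℚ.* (b ℚ.- d)) (d ℚ.* (a ℚ.- c)) ⟩
      ℚ.∣ a ℚ.* (b ℚ.- d) ∣ ℚ.+ ℚ.∣ d ℚ.* (a ℚ.- c) ∣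
        ≤⟨ ℚ.+-mono-≤ (∣*∣-≤ {a} B δ B-pos ∣a∣≤B ∣b-d∣≤δ)
                       (∣*∣-≤ {d} C δ C-pos ∣d∣≤C ∣a-c∣≤δ) ⟩
      B ℚ.* δ ℚ.+ C ℚ.* δ
        ≡⟨ sums-to-ε ⟩
      ε ∎

infix  4 _≈ᵣ_ _≤ᵣ_
infixl 6 _+ᵣ_ _-ᵣ_
infixl 7 _*ᵣ_
infix  8 -ᵣ_

_≈ᵣ_ : ℝ → ℝ → Set
x ≈ᵣ y = ∀ ε → 0ℚ ℚ.< ε →
  ∃ λ N → ∀ n → N ℕ.≤ n → ℚ.∣ seq x n ℚ.- seq y n ∣ ℚ.≤ ε

_≤ᵣ_ : ℝ → ℝ → Set
x ≤ᵣ y = ∀ ε → 0ℚ ℚ.< ε →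
  ∃ λ N → ∀ n → N ℕ.≤ n → seq x n ℚ.≤ seq y n ℚ.+ ε

fromℚᵣ : ℚ → ℝ
fromℚᵣ q = real (λ _ → q) (cauchy-const q)

_+ᵣ_ : ℝ → ℝ → ℝ
x +ᵣ y = real (λ n → seq x n ℚ.+ seq y n) (cauchy-+ x y)

_*ᵣ_ : ℝ → ℝ → ℝ
x *ᵣ y = real (λ n → seq x n ℚ.* seq y n) (cauchy-* x y)

-ᵣ_ : ℝ → ℝ
-ᵣ x = real (λ n → ℚ.- seq x n) (cauchy-neg x)

_-ᵣ_ : ℝ → ℝ → ℝ
x -ᵣ y = x +ᵣ (-ᵣ y)

ℝ-rawRing : RawRing 0ℓ 0ℓ
ℝ-rawRing = record
  { Carrier = ℝ ; _≈_ = _≈ᵣ_ ; _+_ = _+ᵣ_ ; _*_ = _*ᵣ_ ; -_ = -ᵣ_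
  ; 0# = fromℚᵣ 0ℚ ; 1# = fromℚᵣ 1ℚ }

module ℝ-Ops = RawSemiringDefinitions (RawRing.rawSemiring ℝ-rawRing)

record ℂ : Set where
  constructor _+i_
  field
    re im : ℝ

open ℂ public

infix  4 _≈_
infixl 6 _+_
infixl 7 _*_
infix  8 -_

_≈_ : ℂ → ℂ → Set
z ≈ w = re z ≈ᵣ re w × im z ≈ᵣ im w

_+_ : ℂ → ℂ → ℂ
z + w = (re z +ᵣ re w) +i (im z +ᵣ im w)

_*_ : ℂ → ℂ → ℂ
z * w = (re z *ᵣ re w -ᵣ im z *ᵣ im w) +i (re z *ᵣ im w +ᵣ im z *ᵣ re w)

-_ : ℂ → ℂ
- z = (-ᵣ re z) +i (-ᵣ im z)

fromℝ : ℝ → ℂ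
fromℝ x = x +i fromℚᵣ 0ℚ

fromℚ : ℚ → ℂ
fromℚ q = fromℝ (fromℚᵣ q)

0ℂ 1ℂ : ℂ
0ℂ = fromℚ 0ℚ
1ℂ = fromℚ 1ℚ

∣_∣² : ℂ → ℝ
∣ z ∣² = re z *ᵣ re z +ᵣ im z *ᵣ im z

ℂ-rawRing : RawRing 0ℓ 0ℓ
ℂ-rawRing = record
  { Carrier = ℂ ; _≈_ = _≈_ ; _+_ = _+_ ; _*_ = _*_ ; -_ = -_
  ; 0# = 0ℂ ; 1# = 1ℂ }

module ℂ-Ops = RawSemiringDefinitions (RawRing.rawSemiring ℂ-rawRing)

-- The L²-norm on [0,1].  It is only applied to polynomial functions, for
-- which the Lebesgue integral is the limit of the sums over the uniform
-- partitions of [0,1].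

riemannSum : (ℝ → ℝ) → ℕ → ℝ
riemannSum g n =
  fromℚᵣ (+ 1 ℚ./ suc n) *ᵣ
  ℝ-Ops.sum {suc n} (λ k → g (fromℚᵣ (+ toℕ k ℚ./ suc n)))

-- ∫₀¹ g(x) dx = I
Integral₀¹ : (ℝ → ℝ) → ℝ → Set
Integral₀¹ g I = ∀ ε → 0ℚ ℚ.< ε → ∃ λ N → ∀ n → N ℕ.≤ n →
  riemannSum g n ≤ᵣ I +ᵣ fromℚᵣ ε × I ≤ᵣ riemannSum g n +ᵣ fromℚᵣ ε

-- ‖f‖ ≤ ‖g‖, as the comparison ∫₀¹ |f|² ≤ ∫₀¹ |g|² of the squared norms
‖_‖≤‖_‖ : (ℝ → ℂ) → (ℝ → ℂ) → Set
‖ f ‖≤‖ g ‖ = ∀ I J →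
  Integral₀¹ (λ x → ∣ f x ∣²) I → Integral₀¹ (λ x → ∣ g x ∣²) J → I ≤ᵣ J

-- x ↦ c₀ + c₁x + … + cₙxⁿ + z xⁿ⁺¹
extend : (ℕ → ℂ) → ℕ → ℂ → ℝ → ℂ
extend c n z x =
  ℂ-Ops.sum {suc n} (λ k → c (toℕ k) * (fromℝ x ^ toℕ k)) +
  z * (fromℝ x ^ suc n)
  where open ℂ-Ops using (_^_)

-- Minimality determines cₙ₊₁ from c₀, …, cₙ up to _≈_, since ‖xⁿ⁺¹‖ > 0.
IsGreedy : (ℕ → ℂ) → Set
IsGreedy c = c 0 ≈ 1ℂ ×
  (∀ n z → ‖ extend c n (c (suc n)) ‖≤‖ extend c n z ‖)

b : ℕ → ℕ
b n = length (filter (λ d → ¬? (d Fin.≟ 0b)) (proj₁ (toDigits 2 n)))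

-- The largest k with 2ᵏ ∣ n, for n ≥ 1; such k satisfy k < 2ᵏ ≤ n.
ord₂ : ℕ → ℕ
ord₂ n = foldr _⊔_ 0 (filter (λ k → 2 ℕ.^ k ∣? n) (upTo n))

∣_∣₂ : ℚ → ℚ
∣ q ∣₂ =
  if does (q ℚ.≟ 0ℚ) then 0ℚ
  else (+ (2 ℕ.^ ord₂ (↧ₙ q))) ℚ./ (2 ℕ.^ ord₂ ℤ.∣ ↥ q ∣)
  where
  instance
    power≢0 : ℕ.NonZero (2 ℕ.^ ord₂ ℤ.∣ ↥ q ∣)
    power≢0 = ℕ.m^n≢0 2 (ord₂ ℤ.∣ ↥ q ∣)

module Submission where

-- Orthogonality to xⁿ⁺¹ determines cₙ₊₁, since a deviation w from the orthogonal choice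
-- increases the squared norm by |w|² / (2n+3).  It reads cₙ = −(2n+1) Σ_{k<n} cₖ / (n+k+1).
-- Writing cₙ = eₙ / (2n)!, it becomes eₙ = −(2n+1) Σ_{k<n} D(n,k) eₖ, where
-- D(n,k) = (2n)! / ((2k)! (n+k+1)) is an integer, even for k < n−1 and equal to 2n−1 for
-- k = n−1.  Hence every eₙ is an odd integer, and ord₂ ((2n)!) = 2n − b(n) by Legendre.

-- The hypothesis compares norms only through values `I` and `J` that are integrals of the two
-- squared moduli, so it yields nothing until both integrals are shown to exist. The integral of the
-- competitor is never evaluated: it exists because a polynomial is integrable, and the integral for
-- cₙ₊₁ is this unknown value plus multiples of explicit moments, so that the unknown part cancels
-- from I ≤ J.
--
-- The coefficients are Cauchy sequences known only up to `_≈_`, and a value of a polynomial changes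
-- with the approximation index `m`. The algebra is therefore done in ℚ at a fixed `m`, where the
-- ring identities hold exactly; limits enter only through integrals and through the replacement of
-- a coefficient by its rational value.

open import Defs
import Algebra.Properties.Semiring.Exp as SemiringExp
import Algebra.Properties.Semiring.Sum as SemiringSum
open import Algebra.Bundles using (module CommutativeRing)
open import Data.Digit using (Bit; 0b; fromDigits; toDigits)
open import Data.Fin as Fin using (Fin; toℕ)
import Data.Fin.Properties as Fin
open import Data.Integer as ℤ using (ℤ; +_)
import Data.Integer.Divisibility.Signed as ℤ∣
open import Data.Integer.GCD using (gcd)
import Data.Integer.Properties as ℤ
open import Data.List using (List; []; _∷_; length; filter; foldr; upTo)
open import Data.List.Membership.Propositional using (_∈_)
open import Data.List.Membership.Propositional.Properties
  using (∈-filter⁻; ∈-filter⁺; ∈-upTo⁺)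
open import Data.List.Relation.Unary.Any using (here; there)
import Data.Nat as ℕ
open import Data.Nat using (ℕ; zero; suc; _∸_; _!; _⊔_; s≤s; z≤n)
open import Data.Nat.Divisibility
open import Data.Nat.Induction using (<-rec)
open import Data.Nat.Primality using (euclidsLemma; prime[2])
import Data.Nat.Properties as ℕ
open import Data.Nat.Tactic.RingSolver using (solve-∀)
open import Data.Product using (Σ; ∃; _×_; _,_; proj₁; proj₂)
open import Data.Rational as ℚ using (ℚ; mkℚ; 0ℚ; 1ℚ; ½; _/_; ↥_; ↧_; ↧ₙ_)
import Data.Rational.Properties as ℚ
open import Data.Rational.Solver using (module +-*-Solver)
import Data.Rational.Unnormalised as ℚᵘ
import Data.Rational.Unnormalised.Properties as ℚᵘ
open import Data.Sum using (inj₁; inj₂)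
open import Function using (_∘_)
open import Relation.Binary.PropositionalEquality
  using (_≡_; _≢_; refl; sym; trans; cong; cong₂; subst; subst₂; module ≡-Reasoning)
open import Relation.Nullary using (¬_; ¬?; yes; no; contradiction)

open SemiringSum (CommutativeRing.semiring ℚ.+-*-commutativeRing)
  using (sum; sum-cong-≗; *-distribˡ-sum; ∑-distrib-+)
open SemiringExp (CommutativeRing.semiring ℚ.+-*-commutativeRing)
  using (_^_; ^-homo-*)
open ℝ-Ops using () renaming (sum to sumᵣ)
open ℂ-Ops using () renaming (_^_ to _^ᶜ_; sum to sumᶜ)

-- The prime 2

2∤1+2* : ∀ k → 2 ∤ 1 ℕ.+ 2 ℕ.* k
2∤1+2* k 2∣ with ∣1⇒≡1 (∣m+n∣m⇒∣n (subst (2 ∣_) (ℕ.+-comm 1 (2 ℕ.* k)) 2∣) (m∣m*n k))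
... | ()

2∤-* : ∀ {m n} → 2 ∤ m → 2 ∤ n → 2 ∤ m ℕ.* n
2∤-* {m} {n} 2∤m 2∤n 2∣mn with euclidsLemma m n prime[2] 2∣mn
... | inj₁ 2∣m = 2∤m 2∣m
... | inj₂ 2∣n = 2∤n 2∣n

-- Each even factor 2i of (2m)! contributes 2 and i; `r` is the product 1·3···(2m - 1) of the odd
-- factors.
double-! : ∀ m → ∃ λ r → 2 ∤ r × (m ℕ.* 2) ! ≡ 2 ℕ.^ m ℕ.* m ! ℕ.* r
double-! zero = 1 , 2∤1+2* 0 , refl
double-! (suc m) with double-! m
... | r , 2∤r , eq = (1 ℕ.+ 2 ℕ.* m) ℕ.* r , 2∤-* (2∤1+2* m) 2∤r ,
  trans (cong (λ f → (2 ℕ.+ m ℕ.* 2) ℕ.* ((1 ℕ.+ m ℕ.* 2) ℕ.* f)) eq) (regroup m (2 ℕ.^ m) (m !) r)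
  where
  regroup : ∀ m p f r → (2 ℕ.+ m ℕ.* 2) ℕ.* ((1 ℕ.+ m ℕ.* 2) ℕ.* (p ℕ.* f ℕ.* r)) ≡
            2 ℕ.* p ℕ.* (suc m ℕ.* f) ℕ.* ((1 ℕ.+ 2 ℕ.* m) ℕ.* r)
  regroup = solve-∀

-- Binary digits and the order of (2n)!

nonzeros : List Bit → ℕ
nonzeros ds = length (filter (λ d → ¬? (d Fin.≟ 0b)) ds)

-- Makes the truncated subtraction `2 * n ∸ b n` a true one.
nonzeros≤ : ∀ ds → nonzeros ds ℕ.≤ fromDigits ds
nonzeros≤ [] = z≤n
nonzeros≤ (Fin.zero ∷ ds) = ℕ.≤-trans (nonzeros≤ ds) (ℕ.m≤m*n (fromDigits ds) 2)
nonzeros≤ (Fin.suc Fin.zero ∷ ds) = s≤s (ℕ.≤-trans (nonzeros≤ ds) (ℕ.m≤m*n (fromDigits ds) 2))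

-- Legendre's formula at the prime 2: ord₂ (m !) = m − (number of binary ones of m).
legendre : ∀ ds → ∃ λ r → 2 ∤ r ×
  fromDigits ds ! ℕ.* 2 ℕ.^ nonzeros ds ≡ 2 ℕ.^ fromDigits ds ℕ.* r
legendre [] = 1 , 2∤1+2* 0 , refl
-- Digits run from the least significant one, so a digit 0 in front doubles m: by `double-!` the
-- order of the factorial grows by m, while the number of ones stays.
legendre (Fin.zero ∷ ds) with legendre ds | double-! (fromDigits ds)
... | r , 2∤r , eq | r′ , 2∤r′ , eq′ = r ℕ.* r′ , 2∤-* 2∤r 2∤r′ , (begin
  (m ℕ.* 2) ! ℕ.* s                ≡⟨ cong (ℕ._* s) eq′ ⟩
  2 ℕ.^ m ℕ.* m ! ℕ.* r′ ℕ.* s     ≡⟨ swap (2 ℕ.^ m) (m !) r′ s ⟩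
  2 ℕ.^ m ℕ.* (m ! ℕ.* s) ℕ.* r′   ≡⟨ cong (λ t → 2 ℕ.^ m ℕ.* t ℕ.* r′) eq ⟩
  2 ℕ.^ m ℕ.* (2 ℕ.^ m ℕ.* r) ℕ.* r′ ≡⟨ regroup (2 ℕ.^ m) r r′ ⟩
  2 ℕ.^ m ℕ.* 2 ℕ.^ m ℕ.* (r ℕ.* r′) ≡⟨ cong (ℕ._* (r ℕ.* r′)) (square m) ⟩
  2 ℕ.^ (m ℕ.* 2) ℕ.* (r ℕ.* r′)   ∎)
  where
  open ≡-Reasoning
  m = fromDigits ds
  s = 2 ℕ.^ nonzeros ds
  swap : ∀ p f r s → p ℕ.* f ℕ.* r ℕ.* s ≡ p ℕ.* (f ℕ.* s) ℕ.* r
  swap = solve-∀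
  regroup : ∀ p r s → p ℕ.* (p ℕ.* r) ℕ.* s ≡ p ℕ.* p ℕ.* (r ℕ.* s)
  regroup = solve-∀
  square : ∀ m → 2 ℕ.^ m ℕ.* 2 ℕ.^ m ≡ 2 ℕ.^ (m ℕ.* 2)
  square m = trans (cong (2 ℕ.^ m ℕ.*_) (sym (ℕ.*-identityʳ _))) (ℕ.^-*-assoc 2 m 2)
-- The digit 1 adds the odd factor 2m + 1 to (2m)! and one nonzero digit, which accounts for the
-- extra 2 on both sides.
legendre (Fin.suc Fin.zero ∷ ds) with legendre (Fin.zero ∷ ds)
... | r , 2∤r , eq = (1 ℕ.+ 2 ℕ.* m) ℕ.* r , 2∤-* (2∤1+2* m) 2∤r ,
  trans (left m ((m ℕ.* 2) !) s) (trans (cong (2 ℕ.* (1 ℕ.+ 2 ℕ.* m) ℕ.*_) eq) (right m (2 ℕ.^ (m ℕ.* 2)) r))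
  where
  m = fromDigits ds
  s = 2 ℕ.^ nonzeros ds
  left : ∀ m f s → (1 ℕ.+ m ℕ.* 2) ℕ.* f ℕ.* (2 ℕ.* s) ≡ 2 ℕ.* (1 ℕ.+ 2 ℕ.* m) ℕ.* (f ℕ.* s)
  left = solve-∀
  right : ∀ m p r → 2 ℕ.* (1 ℕ.+ 2 ℕ.* m) ℕ.* (p ℕ.* r) ≡ 2 ℕ.* p ℕ.* ((1 ℕ.+ 2 ℕ.* m) ℕ.* r)
  right = solve-∀

[2n]!-decomposition : ∀ n → ∃ λ r → 2 ∤ r × (2 ℕ.* n) ! ≡ 2 ℕ.^ (2 ℕ.* n ∸ b n) ℕ.* r
[2n]!-decomposition n = from-digits (proj₁ (toDigits 2 n)) n (proj₂ (toDigits 2 n))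
  where
  open ≡-Reasoning
  swap : ∀ p q r → p ℕ.* q ℕ.* r ≡ p ℕ.* r ℕ.* q
  swap = solve-∀

  from-digits : ∀ ds n → fromDigits ds ≡ n →
    ∃ λ r → 2 ∤ r × (2 ℕ.* n) ! ≡ 2 ℕ.^ (2 ℕ.* n ∸ nonzeros ds) ℕ.* r
  -- `0b ∷ ds` represents 2n and has as many ones as `ds`.
  from-digits ds n refl with legendre (0b ∷ ds)
  ... | r , 2∤r , eq = r , 2∤r , ℕ.*-cancelʳ-≡ _ _ (2 ℕ.^ s) {{ℕ.m^n≢0 2 s}} (begin
    (2 ℕ.* n) ! ℕ.* 2 ℕ.^ s                    ≡⟨ subst (λ m → m ! ℕ.* 2 ℕ.^ s ≡ 2 ℕ.^ m ℕ.* r) (ℕ.*-comm n 2) eq ⟩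
    2 ℕ.^ (2 ℕ.* n) ℕ.* r                      ≡⟨ cong (λ k → 2 ℕ.^ k ℕ.* r) (ℕ.m∸n+n≡m s≤2n) ⟨
    2 ℕ.^ (2 ℕ.* n ∸ s ℕ.+ s) ℕ.* r            ≡⟨ cong (ℕ._* r) (ℕ.^-distribˡ-+-* 2 (2 ℕ.* n ∸ s) s) ⟩
    2 ℕ.^ (2 ℕ.* n ∸ s) ℕ.* 2 ℕ.^ s ℕ.* r      ≡⟨ swap (2 ℕ.^ (2 ℕ.* n ∸ s)) (2 ℕ.^ s) r ⟩
    2 ℕ.^ (2 ℕ.* n ∸ s) ℕ.* r ℕ.* 2 ℕ.^ s      ∎)
    where
    s = nonzeros ds
    s≤2n : s ℕ.≤ 2 ℕ.* n
    s≤2n = ℕ.≤-trans (nonzeros≤ ds) (ℕ.m≤n*m n 2)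

-- One factor 2 is peeled off at a time: by Euclid's lemma it must divide `q`, as it does not divide
-- `m`.
2∤⇒2^∣-cancelʳ : ∀ K q {m} → 2 ∤ m → 2 ℕ.^ K ∣ q ℕ.* m → 2 ℕ.^ K ∣ q
2∤⇒2^∣-cancelʳ zero q 2∤m _ = 1∣ q
2∤⇒2^∣-cancelʳ (suc K) q {m} 2∤m 2^∣qm
  with euclidsLemma q m prime[2] (∣-trans (m∣m*n (2 ℕ.^ K)) 2^∣qm)
... | inj₂ 2∣m = contradiction 2∣m 2∤m
... | inj₁ (divides q′ refl) = subst (2 ℕ.* 2 ℕ.^ K ∣_) (ℕ.*-comm 2 q′)
  (*-monoʳ-∣ 2 (2∤⇒2^∣-cancelʳ K q′ 2∤m
    (*-cancelˡ-∣ 2 (subst (2 ℕ.* 2 ℕ.^ K ∣_) (shuffle q′ m) 2^∣qm))))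
  where
  shuffle : ∀ q m → q ℕ.* 2 ℕ.* m ≡ 2 ℕ.* (q ℕ.* m)
  shuffle = solve-∀

2^∣-bound : ∀ j K {r} → 2 ∤ r → 2 ℕ.^ j ∣ 2 ℕ.^ K ℕ.* r → j ℕ.≤ K
2^∣-bound j K {r} 2∤r 2^∣ with j ℕ.≤? K
... | yes j≤K = j≤K
... | no j≰K = contradiction
  (*-cancelˡ-∣ (2 ℕ.^ K) {{ℕ.m^n≢0 2 K}}
    (subst (_∣ 2 ℕ.^ K ℕ.* r) (ℕ.*-comm 2 (2 ℕ.^ K))
      (∣-trans (2^-mono-∣ (ℕ.≰⇒> j≰K)) 2^∣)))
  2∤r
  where
  2^-mono-∣ : ∀ {i j} → i ℕ.≤ j → 2 ℕ.^ i ∣ 2 ℕ.^ j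
  2^-mono-∣ {i} {j} i≤j = divides (2 ℕ.^ (j ∸ i))
    (trans (cong (2 ℕ.^_) (sym (ℕ.m∸n+n≡m i≤j))) (ℕ.^-distribˡ-+-* 2 (j ∸ i) i))

foldr-⊔-≤ : ∀ {K xs} → (∀ {x} → x ∈ xs → x ℕ.≤ K) → foldr _⊔_ 0 xs ℕ.≤ K
foldr-⊔-≤ {xs = []} below = z≤n
foldr-⊔-≤ {xs = x ∷ xs} below = ℕ.⊔-lub (below (here refl)) (foldr-⊔-≤ (λ x∈ → below (there x∈)))

∈⇒≤foldr-⊔ : ∀ {x xs} → x ∈ xs → x ℕ.≤ foldr _⊔_ 0 xs
∈⇒≤foldr-⊔ (here refl) = ℕ.m≤m⊔n _ _
∈⇒≤foldr-⊔ {xs = y ∷ _} (there x∈) = ℕ.≤-trans (∈⇒≤foldr-⊔ x∈) (ℕ.m≤n⊔m y _)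

-- `ord₂` is a maximum over a finite search. Nothing above `K` passes the test by `2^∣-bound`, and
-- `K` itself lies in the searched range because K < 2^K ≤ 2^K r.
ord₂-2^*odd : ∀ K {r} → 2 ∤ r → ord₂ (2 ℕ.^ K ℕ.* r) ≡ K
ord₂-2^*odd K {zero} 2∤0 = contradiction (2 ∣0) 2∤0
ord₂-2^*odd K {r@(suc _)} 2∤r = ℕ.≤-antisym
  (foldr-⊔-≤ {xs = filter divisor? candidates}
    (λ x∈ → 2^∣-bound _ K 2∤r (proj₂ (∈-filter⁻ divisor? {xs = candidates} x∈))))
  (∈⇒≤foldr-⊔ {xs = filter divisor? candidates} (∈-filter⁺ divisor? (∈-upTo⁺ K<n) (m∣m*n r)))
  where
  candidates = upTo (2 ℕ.^ K ℕ.* r)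
  divisor? = λ k → 2 ℕ.^ k ∣? 2 ℕ.^ K ℕ.* r
  n<2^n : ∀ n → n ℕ.< 2 ℕ.^ n
  n<2^n zero = s≤s z≤n
  n<2^n (suc n) = ℕ.≤-trans (ℕ.+-mono-≤ (ℕ.m^n>0 2 n) (n<2^n n))
    (ℕ.≤-reflexive (cong (2 ℕ.^ n ℕ.+_) (sym (ℕ.+-identityʳ _))))
  K<n : K ℕ.< 2 ℕ.^ K ℕ.* r
  K<n = ℕ.<-≤-trans (n<2^n K) (ℕ.m≤m*n (2 ℕ.^ K) r)

-- The number (2N)! / ((2k)! (N+k+1)) with N = k+j+1.
recursion-weight : ∀ k j → let N = suc (k ℕ.+ j) in
  ∃ λ D → (2 ℕ.* N) ! ≡ D ℕ.* ((2 ℕ.* k) ! ℕ.* suc (k ℕ.+ N)) ×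
          (j ≡ 0 → 2 ∤ D) × (j ≢ 0 → 2 ∣ D)
-- Here N + k + 1 = 2k + 2, so the division removes the only even factor of (2N)! / (2k)! = (2k +
-- 1)(2k + 2).
recursion-weight k zero = 1 ℕ.+ 2 ℕ.* k ,
  trans (cong _! (index k)) (trans (regroup k ((2 ℕ.* k) !))
    (cong (λ i → (1 ℕ.+ 2 ℕ.* k) ℕ.* ((2 ℕ.* k) ! ℕ.* i)) (index′ k))) ,
  (λ _ → 2∤1+2* k) , λ 0≢0 → contradiction refl 0≢0
  where
  index : ∀ k → 2 ℕ.* suc (k ℕ.+ 0) ≡ 2 ℕ.+ 2 ℕ.* k
  index = solve-∀
  index′ : ∀ k → 2 ℕ.+ 2 ℕ.* k ≡ suc (k ℕ.+ suc (k ℕ.+ 0))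
  index′ = solve-∀
  regroup : ∀ k f → (2 ℕ.+ 2 ℕ.* k) ℕ.* ((1 ℕ.+ 2 ℕ.* k) ℕ.* f) ≡ (1 ℕ.+ 2 ℕ.* k) ℕ.* (f ℕ.* (2 ℕ.+ 2 ℕ.* k))
  regroup = solve-∀
-- Now N + k + 1 = 2k + i + 3 exceeds 2k + 2, so the even factor 2k + 2 survives the division. The
-- remaining factors of (2N)! / (2k)! are 2k + 1, those between 2k + 2 and 2k + i + 3 (their product
-- is `q`), and those above 2k + i + 3 (their product is `q′`).
recursion-weight k (suc i)
  with m≤n⇒m!∣n! (ℕ.m≤m+n (2 ℕ.+ 2 ℕ.* k) i)
     | m≤n⇒m!∣n! {3 ℕ.+ 2 ℕ.* k ℕ.+ i} {2 ℕ.* suc (k ℕ.+ suc i)}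
         (subst (3 ℕ.+ 2 ℕ.* k ℕ.+ i ℕ.≤_) (index k i) (ℕ.m≤m+n _ (suc i)))
  where
  index : ∀ k i → 3 ℕ.+ 2 ℕ.* k ℕ.+ i ℕ.+ suc i ≡ 2 ℕ.* suc (k ℕ.+ suc i)
  index = solve-∀
... | divides q eq | divides q′ eq′ = 2 ℕ.* (suc k ℕ.* (1 ℕ.+ 2 ℕ.* k) ℕ.* q ℕ.* q′) ,
  trans eq′ (trans (cong (λ f → q′ ℕ.* ((3 ℕ.+ 2 ℕ.* k ℕ.+ i) ℕ.* f)) eq) (regroup k i q q′ ((2 ℕ.* k) !))) ,
  (λ ()) , λ _ → m∣m*n (suc k ℕ.* (1 ℕ.+ 2 ℕ.* k) ℕ.* q ℕ.* q′)
  where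
  regroup : ∀ k i q q′ f →
    q′ ℕ.* ((3 ℕ.+ 2 ℕ.* k ℕ.+ i) ℕ.* (q ℕ.* ((2 ℕ.+ 2 ℕ.* k) ℕ.* ((1 ℕ.+ 2 ℕ.* k) ℕ.* f)))) ≡
    2 ℕ.* (suc k ℕ.* (1 ℕ.+ 2 ℕ.* k) ℕ.* q ℕ.* q′) ℕ.* (f ℕ.* suc (k ℕ.+ suc (k ℕ.+ suc i)))
  regroup = solve-∀

-- Fractions with odd numerators and the recursion for eₙ

sumℤ : ∀ {n} → (Fin n → ℤ) → ℤ
sumℤ = SemiringSum.sum ℤ.+-*-semiring

/-* : ∀ i j m n .{{_ : ℕ.NonZero m}} .{{_ : ℕ.NonZero n}} →
      (i / m) ℚ.* (j / n) ≡ ((i ℤ.* j) / (m ℕ.* n)) {{ℕ.m*n≢0 m n}}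
/-* i j (suc m) (suc n) = ℚ.toℚᵘ-injective (begin
  ℚ.toℚᵘ ((i / suc m) ℚ.* (j / suc n))
    ≈⟨ ℚ.toℚᵘ-homo-* (i / suc m) (j / suc n) ⟩
  ℚ.toℚᵘ (i / suc m) ℚᵘ.* ℚ.toℚᵘ (j / suc n)
    ≈⟨ ℚᵘ.*-cong (ℚ.toℚᵘ-fromℚᵘ (ℚᵘ.mkℚᵘ i m)) (ℚ.toℚᵘ-fromℚᵘ (ℚᵘ.mkℚᵘ j n)) ⟩
  ℚᵘ.mkℚᵘ i m ℚᵘ.* ℚᵘ.mkℚᵘ j n
    ≈⟨ ℚ.toℚᵘ-fromℚᵘ (ℚᵘ.mkℚᵘ i m ℚᵘ.* ℚᵘ.mkℚᵘ j n) ⟨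
  ℚ.toℚᵘ ((i ℤ.* j) / (suc m ℕ.* suc n)) ∎)
  where open ℚᵘ.≃-Reasoning

/-≡ : ∀ i j m n .{{_ : ℕ.NonZero m}} .{{_ : ℕ.NonZero n}} →
      i ℤ.* + n ≡ j ℤ.* + m → i / m ≡ j / n
/-≡ i j (suc m) (suc n) eq = ℚ.fromℚᵘ-cong {ℚᵘ.mkℚᵘ i m} {ℚᵘ.mkℚᵘ j n} (ℚᵘ.*≡* eq)

/-+ : ∀ i j m .{{_ : ℕ.NonZero m}} → i / m ℚ.+ j / m ≡ (i ℤ.+ j) / m
/-+ i j (suc m) = ℚ.toℚᵘ-injective (begin
  ℚ.toℚᵘ (i / suc m ℚ.+ j / suc m)
    ≈⟨ ℚ.toℚᵘ-homo-+ (i / suc m) (j / suc m) ⟩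
  ℚ.toℚᵘ (i / suc m) ℚᵘ.+ ℚ.toℚᵘ (j / suc m)
    ≈⟨ ℚᵘ.+-cong (ℚ.toℚᵘ-fromℚᵘ (ℚᵘ.mkℚᵘ i m)) (ℚ.toℚᵘ-fromℚᵘ (ℚᵘ.mkℚᵘ j m)) ⟩
  ℚᵘ.mkℚᵘ i m ℚᵘ.+ ℚᵘ.mkℚᵘ j m
    ≈⟨ ℚᵘ.*≡* (trans (cong (ℤ._* + suc m) (sym (ℤ.*-distribʳ-+ (+ suc m) i j)))
              (trans (ℤ.*-assoc (i ℤ.+ j) (+ suc m) (+ suc m))
                     (cong ((i ℤ.+ j) ℤ.*_) (sym (ℤ.pos-* (suc m) (suc m)))))) ⟩
  ℚᵘ.mkℚᵘ (i ℤ.+ j) m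
    ≈⟨ ℚ.toℚᵘ-fromℚᵘ (ℚᵘ.mkℚᵘ (i ℤ.+ j) m) ⟨
  ℚ.toℚᵘ ((i ℤ.+ j) / suc m) ∎)
  where open ℚᵘ.≃-Reasoning

sum-/ : ∀ {n} (f : Fin n → ℤ) m .{{_ : ℕ.NonZero m}} → sum (λ k → f k / m) ≡ sumℤ f / m
sum-/ {zero} f m = sym (ℚ.0/n≡0 m)
sum-/ {suc n} f m = trans (cong (f Fin.zero / m ℚ.+_) (sum-/ (λ k → f (Fin.suc k)) m))
                          (/-+ (f Fin.zero) (sumℤ (λ k → f (Fin.suc k))) m)

-- Stripping even summands from the front does not change the parity, and the odd last summand is
-- what remains.
last-odd⇒2∤sumℤ : ∀ n (f : Fin (suc n) → ℤ) →
  (∀ k → toℕ k ≢ n → 2 ∣ ℤ.∣ f k ∣) → (∀ k → toℕ k ≡ n → 2 ∤ ℤ.∣ f k ∣) →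
  2 ∤ ℤ.∣ sumℤ f ∣
last-odd⇒2∤sumℤ zero f even odd rewrite ℤ.+-identityʳ (f Fin.zero) = odd Fin.zero refl
last-odd⇒2∤sumℤ (suc n) f even odd 2∣sum =
  last-odd⇒2∤sumℤ n (λ k → f (Fin.suc k)) (λ k k≢n → even (Fin.suc k) (λ eq → k≢n (ℕ.suc-injective eq)))
    (λ k k≡n → odd (Fin.suc k) (cong suc k≡n))
    (ℤ∣.∣⇒∣ᵤ {+ 2} {sumℤ (λ k → f (Fin.suc k))}
      (ℤ∣.∣m+n∣m⇒∣n (ℤ∣.∣ᵤ⇒∣ {+ 2} {sumℤ f} 2∣sum)
                  (ℤ∣.∣ᵤ⇒∣ {+ 2} {f Fin.zero} (even Fin.zero (λ ())))))

module _ (e : ℤ) (2∤e : 2 ∤ ℤ.∣ e ∣) (K R : ℕ) (2∤R : 2 ∤ R)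
         (M : ℕ) .{{_ : ℕ.NonZero M}} (M≡ : M ≡ 2 ℕ.^ K ℕ.* R) where
  private
    u = e / M
    g = ℤ.∣ gcd e (+ M) ∣

    ↥u*g : ℤ.∣ ↥ u ∣ ℕ.* g ≡ ℤ.∣ e ∣
    ↥u*g = trans (sym (ℤ.abs-* (↥ u) (gcd e (+ M)))) (cong ℤ.∣_∣ (ℚ.↥-/ e M))

    ↧u*g : ↧ₙ u ℕ.* g ≡ 2 ℕ.^ K ℕ.* R
    ↧u*g = trans (trans (sym (ℤ.abs-* (↧ u) (gcd e (+ M)))) (cong ℤ.∣_∣ (ℚ.↧-/ e M))) M≡

    -- Reducing `e / M` divides both parts by `g`. As a divisor of the odd `e` it is odd, so the
    -- reduction removes no factor 2 from the denominator.
    2∤g : 2 ∤ g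
    2∤g 2∣g = 2∤e (subst (2 ∣_) ↥u*g (∣n⇒∣m*n ℤ.∣ ↥ u ∣ 2∣g))

  2∤↥/ : 2 ∤ ℤ.∣ ↥ u ∣
  2∤↥/ 2∣↥u = 2∤e (subst (2 ∣_) ↥u*g (∣m⇒∣m*n g 2∣↥u))

  odd/≢0 : u ≢ 0ℚ
  odd/≢0 u≡0 = 2∤↥/ (subst (λ q → 2 ∣ ℤ.∣ ↥ q ∣) (sym u≡0) (2 ∣0))

  -- 2^K divides `↧ₙ u * g` with `g` odd, hence `↧ₙ u`; the cofactor `r` divides `R` and is
  -- therefore odd.
  ↧ₙ-odd/ : ∃ λ r → 2 ∤ r × ↧ₙ u ≡ 2 ℕ.^ K ℕ.* r
  ↧ₙ-odd/ with 2∤⇒2^∣-cancelʳ K (↧ₙ u) 2∤g (divides R (trans ↧u*g (ℕ.*-comm (2 ℕ.^ K) R)))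
  ... | divides r ↧u≡ = r , 2∤r , trans ↧u≡ (ℕ.*-comm r (2 ℕ.^ K))
    where
    r*g≡R : r ℕ.* g ≡ R
    r*g≡R = ℕ.*-cancelˡ-≡ _ _ (2 ℕ.^ K) {{ℕ.m^n≢0 2 K}}
      (trans (shuffle (2 ℕ.^ K) r g) (trans (cong (ℕ._* g) (sym ↧u≡)) ↧u*g))
      where
      shuffle : ∀ p r g → p ℕ.* (r ℕ.* g) ≡ r ℕ.* p ℕ.* g
      shuffle = solve-∀
    2∤r : 2 ∤ r
    2∤r 2∣r = 2∤R (subst (2 ∣_) r*g≡R (∣m⇒∣m*n g 2∣r))

∣∣₂-≡ : ∀ u K r → u ≢ 0ℚ → 2 ∤ ℤ.∣ ↥ u ∣ → 2 ∤ r → ↧ₙ u ≡ 2 ℕ.^ K ℕ.* r →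
  ∣ u ∣₂ ≡ + (2 ℕ.^ K) / 1
∣∣₂-≡ u K r u≢0 2∤↥u 2∤r ↧u≡ with u ℚ.≟ 0ℚ
... | yes u≡0 = contradiction u≡0 u≢0
... | no _ = ℚ./-cong
  {{ℕ.m^n≢0 2 (ord₂ ℤ.∣ ↥ u ∣)}}
  (cong (λ k → + (2 ℕ.^ k)) (trans (cong ord₂ ↧u≡) (ord₂-2^*odd K 2∤r)))
  (cong (2 ℕ.^_) (trans (cong ord₂ (sym (ℕ.*-identityˡ ℤ.∣ ↥ u ∣))) (ord₂-2^*odd 0 2∤↥u)))

_/[2_]! : ℤ → ℕ → ℚ
e /[2 n ]! = (e / (2 ℕ.* n) !) {{(2 ℕ.* n) ℕ.!≢0}}

-- The equation is orthogonality to xⁿ⁺¹, the fraction with denominator k + n + 2 being the inner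
-- product of xᵏ and xⁿ⁺¹. Over the common denominator (2n + 2)! the k-th term has numerator
-- `e k * D k`, which is odd exactly for k = n.
next-coefficient : ∀ n (e : Fin (suc n) → ℤ) → (∀ k → 2 ∤ ℤ.∣ e k ∣) →
  ∃ λ e′ → 2 ∤ ℤ.∣ e′ ∣ ×
    sum (λ k → (e k /[2 toℕ k ]!) ℚ.* (+ 1 / suc (toℕ k ℕ.+ suc n))) ℚ.+
    (e′ /[2 suc n ]!) ℚ.* (+ 1 / suc (suc n ℕ.+ suc n)) ≡ 0ℚ
next-coefficient n e 2∤e = e′ , 2∤e′ , (begin
  sum (λ k → (e k /[2 toℕ k ]!) ℚ.* (+ 1 / suc (toℕ k ℕ.+ N))) ℚ.+ e′ / M ℚ.* (+ 1 / L)
    ≡⟨ cong₂ ℚ._+_ (trans (sum-cong-≗ term) (sum-/ f M)) last-term ⟩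
  s / M ℚ.+ (ℤ.- s) / M
    ≡⟨ /-+ s (ℤ.- s) M ⟩
  (s ℤ.- s) / M
    ≡⟨ trans (cong (_/ M) (ℤ.+-inverseʳ s)) (ℚ.0/n≡0 M) ⟩
  0ℚ ∎)
  where
  open ≡-Reasoning
  N = suc n
  M = (2 ℕ.* N) !
  L = suc (N ℕ.+ N)

  instance
    M≢0 : ℕ.NonZero M
    M≢0 = (2 ℕ.* N) ℕ.!≢0

  n≡ : (k : Fin (suc n)) → toℕ k ℕ.+ (n ∸ toℕ k) ≡ n
  n≡ k = ℕ.m+[n∸m]≡n (Fin.toℕ≤pred[n] k)

  D : Fin (suc n) → ℕ
  D k = proj₁ (recursion-weight (toℕ k) (n ∸ toℕ k))

  f : Fin (suc n) → ℤ
  f k = e k ℤ.* + D k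

  s = sumℤ f
  -- `L` = 2n + 3 undoes the weight `+ 1 / L` of the new coefficient; being odd, it leaves the
  -- parity of `s` unchanged.
  e′ = ℤ.- s ℤ.* + L

  M≡ : ∀ k → M ≡ D k ℕ.* ((2 ℕ.* toℕ k) ! ℕ.* suc (toℕ k ℕ.+ N))
  M≡ k = subst (λ m → (2 ℕ.* suc m) ! ≡ D k ℕ.* ((2 ℕ.* toℕ k) ! ℕ.* suc (toℕ k ℕ.+ suc m)))
    (n≡ k) (proj₁ (proj₂ (recursion-weight (toℕ k) (n ∸ toℕ k))))

  2∤e′ : 2 ∤ ℤ.∣ e′ ∣
  2∤e′ = subst (2 ∤_) (sym (ℤ.abs-* (ℤ.- s) (+ L)))
    (2∤-* (subst (2 ∤_) (sym (ℤ.∣-i∣≡∣i∣ s)) 2∤s)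
          (subst (2 ∤_) (cong (λ i → suc (N ℕ.+ i)) (ℕ.+-identityʳ N)) (2∤1+2* N)))
    where
    2∤s : 2 ∤ ℤ.∣ s ∣
    2∤s = last-odd⇒2∤sumℤ n f
      (λ k k≢n → subst (2 ∣_) (sym (ℤ.abs-* (e k) (+ D k)))
        (∣n⇒∣m*n ℤ.∣ e k ∣ (proj₂ (proj₂ (proj₂ (recursion-weight (toℕ k) (n ∸ toℕ k))))
          λ n∸k≡0 → k≢n (trans (sym (ℕ.+-identityʳ (toℕ k)))
            (trans (cong (toℕ k ℕ.+_) (sym n∸k≡0)) (n≡ k))))))
      (λ k k≡n → subst (2 ∤_) (sym (ℤ.abs-* (e k) (+ D k)))
        (2∤-* (2∤e k) (proj₁ (proj₂ (proj₂ (recursion-weight (toℕ k) (n ∸ toℕ k))))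
          (ℕ.m≤n⇒m∸n≡0 (ℕ.≤-reflexive (sym k≡n))))))

  term : ∀ k → (e k /[2 toℕ k ]!) ℚ.* (+ 1 / suc (toℕ k ℕ.+ N)) ≡ f k / M
  term k = trans (/-* (e k) (+ 1) ((2 ℕ.* toℕ k) !) (suc (toℕ k ℕ.+ N)) {{(2 ℕ.* toℕ k) ℕ.!≢0}})
    (/-≡ (e k ℤ.* + 1) (f k) (Q k) M {{Q≢0 k}}
      (trans (cong₂ ℤ._*_ (ℤ.*-identityʳ (e k)) (trans (cong +_ (M≡ k)) (ℤ.pos-* (D k) (Q k))))
        (sym (ℤ.*-assoc (e k) (+ D k) (+ Q k)))))
    where
    Q : Fin (suc n) → ℕ
    Q k = (2 ℕ.* toℕ k) ! ℕ.* suc (toℕ k ℕ.+ N)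
    Q≢0 : ∀ k → ℕ.NonZero (Q k)
    Q≢0 k = ℕ.m*n≢0 ((2 ℕ.* toℕ k) !) (suc (toℕ k ℕ.+ N)) {{(2 ℕ.* toℕ k) ℕ.!≢0}}

  last-term : e′ / M ℚ.* (+ 1 / L) ≡ (ℤ.- s) / M
  last-term = trans (/-* e′ (+ 1) M L)
    (/-≡ (e′ ℤ.* + 1) (ℤ.- s) (M ℕ.* L) M {{ℕ.m*n≢0 M L}}
      (trans (cong (ℤ._* + M) (ℤ.*-identityʳ e′))
        (trans (ℤ.*-assoc (ℤ.- s) (+ L) (+ M))
          (cong (ℤ.- s ℤ.*_) (trans (sym (ℤ.pos-* L M)) (cong +_ (ℕ.*-comm L M)))))))

-- Riemann sums of powers

sumℕ : ∀ {n} → (Fin n → ℕ) → ℕ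
sumℕ = SemiringSum.sum ℕ.+-*-semiring

sumℤ-+ : ∀ {n} (f : Fin n → ℕ) → sumℤ (λ k → + f k) ≡ + sumℕ f
sumℤ-+ {zero} f = refl
sumℤ-+ {suc n} f = cong (λ s → + f Fin.zero ℤ.+ s) (sumℤ-+ (λ k → f (Fin.suc k)))

sumℕ-last : ∀ n (f : ℕ → ℕ) → sumℕ {suc n} (λ k → f (toℕ k)) ≡ sumℕ {n} (λ k → f (toℕ k)) ℕ.+ f n
sumℕ-last zero f = ℕ.+-identityʳ (f 0)
sumℕ-last (suc n) f = trans (cong (f 0 ℕ.+_) (sumℕ-last n (λ k → f (suc k))))
  (sym (ℕ.+-assoc (f 0) _ (f (suc n))))

/-≤ : ∀ i j m n .{{_ : ℕ.NonZero m}} .{{_ : ℕ.NonZero n}} →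
      i ℤ.* + n ℤ.≤ j ℤ.* + m → i / m ℚ.≤ j / n
/-≤ i j (suc m) (suc n) le = ℚ.toℚᵘ-cancel-≤
  (ℚᵘ.≤-respˡ-≃ (ℚᵘ.≃-sym (ℚ.toℚᵘ-fromℚᵘ (ℚᵘ.mkℚᵘ i m)))
    (ℚᵘ.≤-respʳ-≃ (ℚᵘ.≃-sym (ℚ.toℚᵘ-fromℚᵘ (ℚᵘ.mkℚᵘ j n))) (ℚᵘ.*≤* le)))

∣-∣≤ : ∀ {a c ε} → a ℚ.≤ c ℚ.+ ε → c ℚ.≤ a ℚ.+ ε → ℚ.∣ a ℚ.- c ∣ ℚ.≤ ε
∣-∣≤ {a} {c} {ε} a≤ c≤ with ℚ.∣p∣≡p∨∣p∣≡-p (a ℚ.- c)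
... | inj₁ eq = subst₂ ℚ._≤_ (sym eq) (cancel c ε) (ℚ.+-monoˡ-≤ (ℚ.- c) a≤)
  where
  cancel : ∀ c ε → c ℚ.+ ε ℚ.- c ≡ ε
  cancel = solve 2 (λ c ε → c :+ ε :- c := ε) refl
    where open +-*-Solver
... | inj₂ eq = subst₂ ℚ._≤_ (trans (flip a c) (sym eq)) (cancel a ε) (ℚ.+-monoˡ-≤ (ℚ.- a) c≤)
  where
  open +-*-Solver
  cancel : ∀ c ε → c ℚ.+ ε ℚ.- c ≡ ε
  cancel = solve 2 (λ c ε → c :+ ε :- c := ε) refl
  flip : ∀ a c → c ℚ.- a ≡ ℚ.- (a ℚ.- c)
  flip = solve 2 (λ a c → c :- a := :- (a :- c)) refl

∣-∣≤⇒≤+ : ∀ {a c ε} → ℚ.∣ a ℚ.- c ∣ ℚ.≤ ε → a ℚ.≤ c ℚ.+ ε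
∣-∣≤⇒≤+ {a} {c} {ε} le = begin
  a                       ≡⟨ split a c ⟩
  c ℚ.+ (a ℚ.- c)         ≤⟨ ℚ.+-monoʳ-≤ c (p≤∣p∣ (a ℚ.- c)) ⟩
  c ℚ.+ ℚ.∣ a ℚ.- c ∣     ≤⟨ ℚ.+-monoʳ-≤ c le ⟩
  c ℚ.+ ε                 ∎
  where
  open ℚ.≤-Reasoning
  split : ∀ a c → a ≡ c ℚ.+ (a ℚ.- c)
  split = solve 2 (λ a c → a := c :+ (a :- c)) refl
    where open +-*-Solver
  p≤∣p∣ : ∀ p → p ℚ.≤ ℚ.∣ p ∣
  p≤∣p∣ p with ℚ.≤-total 0ℚ p
  ... | inj₁ 0≤p = ℚ.≤-reflexive (sym (ℚ.0≤p⇒∣p∣≡p 0≤p))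
  ... | inj₂ p≤0 = ℚ.≤-trans p≤0 (ℚ.0≤∣p∣ p)

archimedean : ∀ ε → 0ℚ ℚ.< ε → ∃ λ N → ∀ n → N ℕ.≤ n → + 1 / suc n ℚ.≤ ε
-- `ε` is (p + 1) / (d + 1), so 1 / (n + 1) ≤ 1 / (d + 1) ≤ ε as soon as d ≤ n.
archimedean ε@(mkℚ (+ suc p) d _) 0<ε = d , λ n d≤n →
  subst (+ 1 / suc n ℚ.≤_) (ℚ.↥p/↧p≡p ε)
    (/-≤ (+ 1) (+ suc p) (suc n) (suc d)
      (subst (ℤ._≤ + suc p ℤ.* + suc n) (sym (ℤ.*-identityˡ (+ suc d)))
        (subst (+ suc d ℤ.≤_) (ℤ.pos-* (suc p) (suc n))
          (ℤ.+≤+ (ℕ.≤-trans (s≤s d≤n) (ℕ.m≤n*m (suc n) (suc p)))))))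
archimedean ε@(mkℚ (+ zero) d _) 0<ε with ℚ.positive 0<ε
... | ()
archimedean ε@(mkℚ ℤ.-[1+ _ ] d _) 0<ε with ℚ.positive 0<ε
... | ()

-- With `suc-^-upper` this bounds (k + 1)^(d + 1) - k^(d + 1) between (d + 1) k^d and (d + 1) (k +
-- 1)^d, as the mean value theorem does. Summed over k, the differences telescope and enclose the
-- power sum.
suc-^-lower : ∀ d k → suc d ℕ.* k ℕ.^ d ℕ.+ k ℕ.^ suc d ℕ.≤ suc k ℕ.^ suc d
suc-^-lower zero k = ℕ.≤-reflexive (eq k)
  where
  eq : ∀ k → 1 ℕ.* 1 ℕ.+ k ℕ.* 1 ≡ suc k ℕ.* 1
  eq = solve-∀
suc-^-lower (suc d) k = begin
  suc (suc d) ℕ.* k ℕ.^ suc d ℕ.+ k ℕ.^ suc (suc d)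
    ≤⟨ ℕ.m≤m+n _ (suc d ℕ.* k ℕ.^ d) ⟩
  suc (suc d) ℕ.* (k ℕ.* k ℕ.^ d) ℕ.+ k ℕ.* (k ℕ.* k ℕ.^ d) ℕ.+ suc d ℕ.* k ℕ.^ d
    ≡⟨ regroup d k (k ℕ.^ d) ⟩
  suc k ℕ.* (suc d ℕ.* k ℕ.^ d ℕ.+ k ℕ.* k ℕ.^ d)
    ≤⟨ ℕ.*-monoʳ-≤ (suc k) (suc-^-lower d k) ⟩
  suc k ℕ.* suc k ℕ.^ suc d ∎
  where
  open ℕ.≤-Reasoning
  regroup : ∀ d k p → suc (suc d) ℕ.* (k ℕ.* p) ℕ.+ k ℕ.* (k ℕ.* p) ℕ.+ suc d ℕ.* p ≡
    suc k ℕ.* (suc d ℕ.* p ℕ.+ k ℕ.* p)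
  regroup = solve-∀

suc-^-upper : ∀ d k → suc k ℕ.^ suc d ℕ.≤ k ℕ.^ suc d ℕ.+ suc d ℕ.* suc k ℕ.^ d
suc-^-upper zero k = ℕ.≤-reflexive (eq k)
  where
  eq : ∀ k → suc k ℕ.* 1 ≡ k ℕ.* 1 ℕ.+ 1 ℕ.* 1
  eq = solve-∀
suc-^-upper (suc d) k = begin
  q ℕ.+ k ℕ.* q
    ≤⟨ ℕ.+-monoʳ-≤ q (ℕ.*-monoʳ-≤ k (suc-^-upper d k)) ⟩
  q ℕ.+ k ℕ.* (k ℕ.^ suc d ℕ.+ suc d ℕ.* p)
    ≤⟨ ℕ.m≤m+n _ (suc d ℕ.* p) ⟩
  suc k ℕ.* p ℕ.+ k ℕ.* (k ℕ.^ suc d ℕ.+ suc d ℕ.* p) ℕ.+ suc d ℕ.* p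
    ≡⟨ regroup d k p (k ℕ.^ suc d) ⟩
  k ℕ.* k ℕ.^ suc d ℕ.+ suc (suc d) ℕ.* (suc k ℕ.* p) ∎
  where
  open ℕ.≤-Reasoning
  p = suc k ℕ.^ d
  q = suc k ℕ.^ suc d
  regroup : ∀ d k p r → suc k ℕ.* p ℕ.+ k ℕ.* (r ℕ.+ suc d ℕ.* p) ℕ.+ suc d ℕ.* p ≡
    k ℕ.* r ℕ.+ suc (suc d) ℕ.* (suc k ℕ.* p)
  regroup = solve-∀

powerSum : ℕ → ℕ → ℕ
powerSum d n = sumℕ {n} (λ k → toℕ k ℕ.^ d)

powerSum-upper : ∀ d n → suc d ℕ.* powerSum d n ℕ.≤ n ℕ.^ suc d
powerSum-upper d zero = ℕ.≤-reflexive (ℕ.*-zeroʳ (suc d))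
powerSum-upper d (suc n) = begin
  suc d ℕ.* powerSum d (suc n)                     ≡⟨ cong (suc d ℕ.*_) (sumℕ-last n (ℕ._^ d)) ⟩
  suc d ℕ.* (powerSum d n ℕ.+ n ℕ.^ d)             ≡⟨ ℕ.*-distribˡ-+ (suc d) (powerSum d n) (n ℕ.^ d) ⟩
  suc d ℕ.* powerSum d n ℕ.+ suc d ℕ.* n ℕ.^ d     ≤⟨ ℕ.+-monoˡ-≤ _ (powerSum-upper d n) ⟩
  n ℕ.^ suc d ℕ.+ suc d ℕ.* n ℕ.^ d                ≡⟨ ℕ.+-comm (n ℕ.^ suc d) _ ⟩
  suc d ℕ.* n ℕ.^ d ℕ.+ n ℕ.^ suc d                ≤⟨ suc-^-lower d n ⟩
  suc n ℕ.^ suc d                                  ∎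
  where open ℕ.≤-Reasoning

powerSum-lower : ∀ d n → n ℕ.^ suc d ℕ.≤ suc d ℕ.* (powerSum d n ℕ.+ n ℕ.^ d)
powerSum-lower d zero = z≤n
powerSum-lower d (suc n) = begin
  suc n ℕ.^ suc d
    ≤⟨ suc-^-upper d n ⟩
  n ℕ.^ suc d ℕ.+ suc d ℕ.* suc n ℕ.^ d
    ≤⟨ ℕ.+-monoˡ-≤ _ (powerSum-lower d n) ⟩
  suc d ℕ.* (powerSum d n ℕ.+ n ℕ.^ d) ℕ.+ suc d ℕ.* suc n ℕ.^ d
    ≡⟨ ℕ.*-distribˡ-+ (suc d) (powerSum d n ℕ.+ n ℕ.^ d) (suc n ℕ.^ d) ⟨
  suc d ℕ.* (powerSum d n ℕ.+ n ℕ.^ d ℕ.+ suc n ℕ.^ d)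
    ≡⟨ cong (λ s → suc d ℕ.* (s ℕ.+ suc n ℕ.^ d)) (sumℕ-last n (ℕ._^ d)) ⟨
  suc d ℕ.* (powerSum d (suc n) ℕ.+ suc n ℕ.^ d) ∎
  where open ℕ.≤-Reasoning

/-^ : ∀ k n d .{{_ : ℕ.NonZero n}} → (+ k / n) ^ d ≡ (+ (k ℕ.^ d) / n ℕ.^ d) {{ℕ.m^n≢0 n d}}
/-^ k n zero = refl
/-^ k n (suc d) = trans (cong ((+ k / n) ℚ.*_) (/-^ k n d))
  (trans (/-* (+ k) (+ (k ℕ.^ d)) n (n ℕ.^ d))
    (ℚ./-cong {{ℕ.m*n≢0 n (n ℕ.^ d)}} {{ℕ.m^n≢0 n (suc d)}} (sym (ℤ.pos-* k (k ℕ.^ d))) refl))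
  where
  instance
    n^d≢0 : ℕ.NonZero (n ℕ.^ d)
    n^d≢0 = ℕ.m^n≢0 n d

-- The function x^d is nondecreasing on [0,1], so the left-endpoint sum lies below the integral, and
-- adding the endpoint term 1 / (n + 1) brings it above.
riemann-power : ∀ d n →
  ℚ.∣ (+ 1 / suc n) ℚ.* sum {suc n} (λ k → (+ toℕ k / suc n) ^ d) ℚ.- (+ 1 / suc d) ∣ ℚ.≤ + 1 / suc n
riemann-power d n = ∣-∣≤
  (begin
    (+ 1 / N) ℚ.* sum {N} (λ k → (+ toℕ k / N) ^ d)   ≡⟨ value ⟩
    + T / N ℕ.^ suc d                                 ≤⟨ /-≤ (+ T) (+ 1) (N ℕ.^ suc d) (suc d) upper ⟩
    + 1 / suc d                                       ≡⟨ ℚ.+-identityʳ _ ⟨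
    (+ 1 / suc d) ℚ.+ 0ℚ                              ≤⟨ ℚ.+-monoʳ-≤ (+ 1 / suc d) (/-≤ (+ 0) (+ 1) 1 N (ℤ.+≤+ z≤n)) ⟩
    (+ 1 / suc d) ℚ.+ (+ 1 / N)                       ∎)
  (begin
    + 1 / suc d
      ≤⟨ /-≤ (+ 1) (+ (T ℕ.+ N ℕ.^ d)) (suc d) (N ℕ.^ suc d) lower ⟩
    + (T ℕ.+ N ℕ.^ d) / N ℕ.^ suc d
      ≡⟨ /-+ (+ T) (+ (N ℕ.^ d)) (N ℕ.^ suc d) ⟨
    (+ T / N ℕ.^ suc d) ℚ.+ (+ (N ℕ.^ d) / N ℕ.^ suc d)
      ≡⟨ cong₂ ℚ._+_ (sym value) (/-≡ (+ (N ℕ.^ d)) (+ 1) (N ℕ.^ suc d) N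
           (trans (sym (ℤ.pos-* (N ℕ.^ d) N)) (trans (cong +_ (ℕ.*-comm (N ℕ.^ d) N)) (sym (ℤ.*-identityˡ (+ (N ℕ.^ suc d))))))) ⟩
    (+ 1 / N) ℚ.* sum {N} (λ k → (+ toℕ k / N) ^ d) ℚ.+ (+ 1 / N) ∎)
  where
  open ℚ.≤-Reasoning
  N = suc n
  T = powerSum d N
  instance
    N^d≢0 : ℕ.NonZero (N ℕ.^ d)
    N^d≢0 = ℕ.m^n≢0 N d
    N^1+d≢0 : ℕ.NonZero (N ℕ.^ suc d)
    N^1+d≢0 = ℕ.m^n≢0 N (suc d)

  value : (+ 1 / N) ℚ.* sum {N} (λ k → (+ toℕ k / N) ^ d) ≡ + T / N ℕ.^ suc d
  value = trans (cong ((+ 1 / N) ℚ.*_)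
            (trans (sum-cong-≗ {N} (λ k → /-^ (toℕ k) N d))
              (trans (sum-/ {N} (λ k → + (toℕ k ℕ.^ d)) (N ℕ.^ d))
                (cong (_/ N ℕ.^ d) (sumℤ-+ {N} (λ k → toℕ k ℕ.^ d))))))
          (trans (/-* (+ 1) (+ T) N (N ℕ.^ d)) (ℚ./-cong {{ℕ.m*n≢0 N (N ℕ.^ d)}} {{N^1+d≢0}} (ℤ.*-identityˡ (+ T)) refl))

  upper : + T ℤ.* + suc d ℤ.≤ + 1 ℤ.* + (N ℕ.^ suc d)
  upper = subst₂ ℤ._≤_ (trans (cong +_ (ℕ.*-comm (suc d) T)) (ℤ.pos-* T (suc d)))
    (sym (ℤ.*-identityˡ (+ (N ℕ.^ suc d)))) (ℤ.+≤+ (powerSum-upper d N))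

  lower : + 1 ℤ.* + (N ℕ.^ suc d) ℤ.≤ + (T ℕ.+ N ℕ.^ d) ℤ.* + suc d
  lower = subst₂ ℤ._≤_ (sym (ℤ.*-identityˡ (+ (N ℕ.^ suc d))))
    (trans (cong +_ (ℕ.*-comm (suc d) (T ℕ.+ N ℕ.^ d))) (ℤ.pos-* (T ℕ.+ N ℕ.^ d) (suc d)))
    (ℤ.+≤+ (powerSum-lower d N))

-- Integrals of polynomials

-- One tolerance of `_≈ᵣ_`, stated for bare rational sequences so that no Cauchy proofs have to be
-- carried along.
Close : ℚ → (ℕ → ℚ) → (ℕ → ℚ) → Set
Close ε s t = ∃ λ M → ∀ m → M ℕ.≤ m → ℚ.∣ s m ℚ.- t m ∣ ℚ.≤ ε

0<½* : ∀ {ε} → 0ℚ ℚ.< ε → 0ℚ ℚ.< ½ ℚ.* ε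
0<½* = ℚ.*-monoʳ-<-pos ½

½+½ : ∀ ε → ½ ℚ.* ε ℚ.+ ½ ℚ.* ε ≡ ε
½+½ ε = trans (sym (ℚ.*-distribʳ-+ ε ½ ½)) (ℚ.*-identityˡ ε)

∣-∣-comm : ∀ p q → ℚ.∣ p ℚ.- q ∣ ≡ ℚ.∣ q ℚ.- p ∣
∣-∣-comm p q = trans (sym (ℚ.∣-p∣≡∣p∣ (p ℚ.- q))) (cong ℚ.∣_∣ (flip p q))
  where
  flip : ∀ p q → ℚ.- (p ℚ.- q) ≡ q ℚ.- p
  flip = solve 2 (λ p q → :- (p :- q) := q :- p) refl
    where open +-*-Solver

close-cong : ∀ ε {s s′ t t′} → (∀ m → s m ≡ s′ m) → (∀ m → t m ≡ t′ m) → Close ε s t → Close ε s′ t′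
close-cong ε s≡ t≡ (M , close) = M , λ m M≤m →
  subst₂ (λ p q → ℚ.∣ p ℚ.- q ∣ ℚ.≤ ε) (s≡ m) (t≡ m) (close m M≤m)

close-sym : ∀ ε s t → Close ε s t → Close ε t s
close-sym ε s t (M , close) = M , λ m M≤m → subst (ℚ._≤ ε) (∣-∣-comm (s m) (t m)) (close m M≤m)

close-+ : ∀ ε s s′ t t′ → Close (½ ℚ.* ε) s t → Close (½ ℚ.* ε) s′ t′ →
  Close ε (λ m → s m ℚ.+ s′ m) (λ m → t m ℚ.+ t′ m)
close-+ ε s s′ t t′ (M , close) (M′ , close′) = M ⊔ M′ , λ m m≥ → begin
    ℚ.∣ (s m ℚ.+ s′ m) ℚ.- (t m ℚ.+ t′ m) ∣
      ≡⟨ cong ℚ.∣_∣ (regroup (s m) (s′ m) (t m) (t′ m)) ⟩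
    ℚ.∣ (s m ℚ.- t m) ℚ.+ (s′ m ℚ.- t′ m) ∣
      ≤⟨ ℚ.∣p+q∣≤∣p∣+∣q∣ (s m ℚ.- t m) (s′ m ℚ.- t′ m) ⟩
    ℚ.∣ s m ℚ.- t m ∣ ℚ.+ ℚ.∣ s′ m ℚ.- t′ m ∣
      ≤⟨ ℚ.+-mono-≤ (close m (ℕ.m⊔n≤o⇒m≤o M M′ m≥)) (close′ m (ℕ.m⊔n≤o⇒n≤o M M′ m≥)) ⟩
    ½ ℚ.* ε ℚ.+ ½ ℚ.* ε
      ≡⟨ ½+½ ε ⟩
    ε ∎
  where
  open ℚ.≤-Reasoning
  regroup : ∀ a b c d → (a ℚ.+ b) ℚ.- (c ℚ.+ d) ≡ (a ℚ.- c) ℚ.+ (b ℚ.- d)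
  regroup = solve 4 (λ a b c d → (a :+ b) :- (c :+ d) := (a :- c) :+ (b :- d)) refl
    where open +-*-Solver

close-trans : ∀ ε s t r → Close (½ ℚ.* ε) s t → Close (½ ℚ.* ε) t r → Close ε s r
close-trans ε s t r close close′ =
  let M , close″ = close-+ ε s t t r close close′
  in M , λ m M≤m → subst (λ p → ℚ.∣ p ∣ ℚ.≤ ε) (telescope (s m) (t m) (r m)) (close″ m M≤m)
  where
  telescope : ∀ a b c → (a ℚ.+ b) ℚ.- (b ℚ.+ c) ≡ a ℚ.- c
  telescope = solve 3 (λ a b c → (a :+ b) :- (b :+ c) := a :- c) refl
    where open +-*-Solver

≐⇒≈ᵣ : ∀ x y → (∀ m → seq x m ≡ seq y m) → x ≈ᵣ y
≐⇒≈ᵣ x y x≐y ε 0<ε = 0 , λ m _ → subst (λ d → ℚ.∣ d ∣ ℚ.≤ ε)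
  (trans (sym (ℚ.+-inverseʳ (seq y m))) (cong (ℚ._- seq y m) (sym (x≐y m)))) (ℚ.<⇒≤ 0<ε)

eventually-bounded : ∀ x → ∃ λ B → ℚ.Positive B × ∃ λ N → ∀ m → N ℕ.≤ m → ℚ.∣ seq x m ∣ ℚ.≤ B
eventually-bounded x with cauchy x 1ℚ (ℚ.positive⁻¹ 1ℚ)
... | N , close = 1ℚ ℚ.+ ℚ.∣ seq x N ∣ ,
  ℚ.positive (ℚ.+-mono-<-≤ (ℚ.positive⁻¹ 1ℚ) (ℚ.0≤∣p∣ (seq x N))) , N , λ m N≤m → begin
    ℚ.∣ seq x m ∣
      ≡⟨ cong ℚ.∣_∣ (split (seq x m) (seq x N)) ⟩
    ℚ.∣ (seq x m ℚ.- seq x N) ℚ.+ seq x N ∣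
      ≤⟨ ℚ.∣p+q∣≤∣p∣+∣q∣ (seq x m ℚ.- seq x N) (seq x N) ⟩
    ℚ.∣ seq x m ℚ.- seq x N ∣ ℚ.+ ℚ.∣ seq x N ∣
      ≤⟨ ℚ.+-monoˡ-≤ ℚ.∣ seq x N ∣ (close m N N≤m ℕ.≤-refl) ⟩
    1ℚ ℚ.+ ℚ.∣ seq x N ∣ ∎
  where
  open ℚ.≤-Reasoning
  split : ∀ a b → a ≡ (a ℚ.- b) ℚ.+ b
  split = solve 2 (λ a b → a := (a :- b) :+ b) refl
    where open +-*-Solver

divide : ∀ B ε → ℚ.Positive B → 0ℚ ℚ.< ε → ∃ λ δ → 0ℚ ℚ.< δ × B ℚ.* δ ≡ ε
divide B ε B-pos 0<ε = δ , ℚ.positive⁻¹ δ {{δ-pos}} , B*δ≡ε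
  where
  instance
    B≢0 : ℚ.NonZero B
    B≢0 = ℚ.pos⇒nonZero B {{B-pos}}

  δ = ℚ.1/ B ℚ.* ε

  δ-pos : ℚ.Positive δ
  δ-pos = ℚ.pos*pos⇒pos (ℚ.1/ B) {{ℚ.1/pos⇒pos B {{B-pos}}}} ε {{ℚ.positive 0<ε}}

  B*δ≡ε : B ℚ.* δ ≡ ε
  B*δ≡ε = trans (sym (ℚ.*-assoc B (ℚ.1/ B) ε))
    (trans (cong (ℚ._* ε) (ℚ.*-inverseʳ B)) (ℚ.*-identityˡ ε))

-- A Cauchy sequence is eventually bounded by some B, and δ = ε / B works. It depends on `a` and `ε`
-- alone: in `HasIntegral-*` one δ has to serve all partitions.
close-* : ∀ a ε → 0ℚ ℚ.< ε → ∃ λ δ → 0ℚ ℚ.< δ ×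
  (∀ s t → Close δ s t → Close ε (λ m → seq a m ℚ.* s m) (λ m → seq a m ℚ.* t m))
close-* a ε 0<ε =
  let B , B-pos , N , ∣a∣≤B = eventually-bounded a
      δ , 0<δ , B*δ≡ε = divide B ε B-pos 0<ε
  in δ , 0<δ , scaled B δ N B-pos ∣a∣≤B B*δ≡ε
  where
  scaled : ∀ B δ N → ℚ.Positive B → (∀ m → N ℕ.≤ m → ℚ.∣ seq a m ∣ ℚ.≤ B) → B ℚ.* δ ≡ ε →
    ∀ s t → Close δ s t → Close ε (λ m → seq a m ℚ.* s m) (λ m → seq a m ℚ.* t m)
  scaled B δ N B-pos ∣a∣≤B B*δ≡ε s t (M , close) = N ⊔ M , λ m m≥ → begin
    ℚ.∣ seq a m ℚ.* s m ℚ.- seq a m ℚ.* t m ∣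
      ≡⟨ cong ℚ.∣_∣ (factor (seq a m) (s m) (t m)) ⟩
    ℚ.∣ seq a m ℚ.* (s m ℚ.- t m) ∣
      ≡⟨ ℚ.∣p*q∣≡∣p∣*∣q∣ (seq a m) (s m ℚ.- t m) ⟩
    ℚ.∣ seq a m ∣ ℚ.* ℚ.∣ s m ℚ.- t m ∣
      ≤⟨ ℚ.*-monoʳ-≤-nonNeg ℚ.∣ s m ℚ.- t m ∣
           {{ℚ.∣-∣-nonNeg (s m ℚ.- t m)}} (∣a∣≤B m (ℕ.m⊔n≤o⇒m≤o N M m≥)) ⟩
    B ℚ.* ℚ.∣ s m ℚ.- t m ∣
      ≤⟨ ℚ.*-monoˡ-≤-nonNeg B {{ℚ.pos⇒nonNeg B {{B-pos}}}} (close m (ℕ.m⊔n≤o⇒n≤o N M m≥)) ⟩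
    B ℚ.* δ
      ≡⟨ B*δ≡ε ⟩
    ε ∎
    where
    open ℚ.≤-Reasoning
    factor : ∀ a x y → a ℚ.* x ℚ.- a ℚ.* y ≡ a ℚ.* (x ℚ.- y)
    factor = solve 3 (λ a x y → a :* x :- a :* y := a :* (x :- y)) refl
      where open +-*-Solver

≈ᵣ-*-fromℚᵣ : ∀ x u q → x ≈ᵣ fromℚᵣ u → (x *ᵣ fromℚᵣ q) ≈ᵣ fromℚᵣ (u ℚ.* q)
≈ᵣ-*-fromℚᵣ x u q x≈u ε 0<ε =
  let δ , 0<δ , scaled = close-* (fromℚᵣ q) ε 0<ε
  in close-cong ε (λ m → ℚ.*-comm q (seq x m)) (λ _ → ℚ.*-comm q u)
       (scaled (seq x) (λ _ → u) (x≈u δ 0<δ))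

seq-sumᵣ : ∀ {n} (f : Fin n → ℝ) m → seq (sumᵣ f) m ≡ sum (λ k → seq (f k) m)
seq-sumᵣ {zero} f m = refl
seq-sumᵣ {suc n} f m = cong (seq (f Fin.zero) m ℚ.+_) (seq-sumᵣ (f ∘ Fin.suc) m)

average : (ℝ → ℕ → ℚ) → ℕ → ℕ → ℚ
average F n m = (+ 1 / suc n) ℚ.* sum {suc n} (λ k → F (fromℚᵣ (+ toℕ k / suc n)) m)

seq-riemannSum : ∀ g n m → seq (riemannSum g n) m ≡ average (λ x m → seq (g x) m) n m
seq-riemannSum g n m = cong ((+ 1 / suc n) ℚ.*_) (seq-sumᵣ {suc n} (λ k → g (fromℚᵣ (+ toℕ k / suc n))) m)

opaque
  -- An integrand is given by the approximations of its values only: comparing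
  -- functions into ℝ would make Agda compare proofs of the Cauchy property.
  HasIntegral : (ℝ → ℕ → ℚ) → ℝ → Set
  HasIntegral F I = ∀ ε → 0ℚ ℚ.< ε → ∃ λ N → ∀ n → N ℕ.≤ n →
    ∃ λ M → ∀ m → M ℕ.≤ m → ℚ.∣ average F n m ℚ.- seq I m ∣ ℚ.≤ ε

  HasIntegral⇒Integral₀¹ : ∀ g {I} → HasIntegral (λ x m → seq (g x) m) I → Integral₀¹ g I
  HasIntegral⇒Integral₀¹ g {I} has ε 0<ε =
    let N , close = has ε 0<ε
    in N , λ n N≤n →
      (λ δ 0<δ → proj₁ (close n N≤n) , λ m M≤m →
        subst (ℚ._≤ seq I m ℚ.+ ε ℚ.+ δ) (sym (seq-riemannSum g n m))
          (weaken 0<δ (∣-∣≤⇒≤+ (proj₂ (close n N≤n) m M≤m)))) ,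
      (λ δ 0<δ → proj₁ (close n N≤n) , λ m M≤m →
        subst (λ s → seq I m ℚ.≤ s ℚ.+ ε ℚ.+ δ) (sym (seq-riemannSum g n m))
          (weaken 0<δ (∣-∣≤⇒≤+ (subst (ℚ._≤ ε) (∣-∣-comm (average (λ x m → seq (g x) m) n m) (seq I m))
            (proj₂ (close n N≤n) m M≤m)))))
    where
    weaken : ∀ {x y δ} → 0ℚ ℚ.< δ → x ℚ.≤ y → x ℚ.≤ y ℚ.+ δ
    weaken {x} {y} {δ} 0<δ x≤y = subst (ℚ._≤ y ℚ.+ δ) (ℚ.+-identityʳ x) (ℚ.+-mono-≤ x≤y (ℚ.<⇒≤ 0<δ))

  HasIntegral-cong : ∀ F G {I} → (∀ x m → F x m ≡ G x m) → HasIntegral F I → HasIntegral G I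
  HasIntegral-cong F G {I} F≡G has ε 0<ε =
    let N , close = has ε 0<ε
    in N , λ n N≤n → proj₁ (close n N≤n) , λ m M≤m →
      subst (λ s → ℚ.∣ s ℚ.- seq I m ∣ ℚ.≤ ε)
        (cong ((+ 1 / suc n) ℚ.*_) (sum-cong-≗ {suc n} (λ k → F≡G (fromℚᵣ (+ toℕ k / suc n)) m)))
        (proj₂ (close n N≤n) m M≤m)

  HasIntegral-≈ : ∀ F I J → I ≈ᵣ J → HasIntegral F I → HasIntegral F J
  HasIntegral-≈ F I J I≈J has ε 0<ε =
    let N , close = has (½ ℚ.* ε) (0<½* 0<ε)
    in N , λ n N≤n → close-trans ε (average F n) (seq I) (seq J) (close n N≤n) (I≈J (½ ℚ.* ε) (0<½* 0<ε))

  HasIntegral-+ : ∀ F G I J → HasIntegral F I → HasIntegral G J →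
    HasIntegral (λ x m → F x m ℚ.+ G x m) (I +ᵣ J)
  HasIntegral-+ F G I J has has′ ε 0<ε =
    let N , close = has (½ ℚ.* ε) (0<½* 0<ε)
        N′ , close′ = has′ (½ ℚ.* ε) (0<½* 0<ε)
    in N ⊔ N′ , λ n n≥ → close-cong ε (additive n) (λ _ → refl)
      (close-+ ε (average F n) (average G n) (seq I) (seq J)
        (close n (ℕ.m⊔n≤o⇒m≤o N N′ n≥)) (close′ n (ℕ.m⊔n≤o⇒n≤o N N′ n≥)))
    where
    additive : ∀ n m → average F n m ℚ.+ average G n m ≡ average (λ x m → F x m ℚ.+ G x m) n m
    additive n m = trans (sym (ℚ.*-distribˡ-+ (+ 1 / suc n) (sum f) (sum g)))
      (cong ((+ 1 / suc n) ℚ.*_) (sym (∑-distrib-+ f g)))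
      where
      f g : Fin (suc n) → ℚ
      f k = F (fromℚᵣ (+ toℕ k / suc n)) m
      g k = G (fromℚᵣ (+ toℕ k / suc n)) m

  HasIntegral-* : ∀ a F I → HasIntegral F I → HasIntegral (λ x m → seq a m ℚ.* F x m) (a *ᵣ I)
  HasIntegral-* a F I has ε 0<ε =
    let δ , 0<δ , scaled = close-* a ε 0<ε
        N , close = has δ 0<δ
    in N , λ n N≤n → close-cong ε (homogeneous n) (λ _ → refl)
         (scaled (average F n) (seq I) (close n N≤n))
    where
    exchange : ∀ a b c → a ℚ.* (b ℚ.* c) ≡ b ℚ.* (a ℚ.* c)
    exchange = solve 3 (λ a b c → a :* (b :* c) := b :* (a :* c)) refl
      where open +-*-Solver
    homogeneous : ∀ n m → seq a m ℚ.* average F n m ≡ average (λ x m → seq a m ℚ.* F x m) n m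
    homogeneous n m = trans (exchange (seq a m) (+ 1 / suc n) (sum f))
      (cong ((+ 1 / suc n) ℚ.*_) (*-distribˡ-sum (seq a m) f))
      where
      f : Fin (suc n) → ℚ
      f k = F (fromℚᵣ (+ toℕ k / suc n)) m

  HasIntegral-^ : ∀ d → HasIntegral (λ x m → seq x m ^ d) (fromℚᵣ (+ 1 / suc d))
  HasIntegral-^ d ε 0<ε =
    let N , small = archimedean ε 0<ε
    -- The sample points are constant sequences, so the average does not depend on `m` and every
    -- index from 0 on will do.
    in N , λ n N≤n → 0 , λ m _ → ℚ.≤-trans (riemann-power d n) (small n N≤n)

-- Indexed by the integrand itself, with real coefficients entering through their approximations:
-- products need no expansion into a list of coefficients.
data Polynomial : (ℝ → ℕ → ℚ) → Set where
  const : ∀ a → Polynomial (λ _ m → seq a m)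
  var   : Polynomial (λ x m → seq x m)
  add   : ∀ {F G} → Polynomial F → Polynomial G → Polynomial (λ x m → F x m ℚ.+ G x m)
  mul   : ∀ {F G} → Polynomial F → Polynomial G → Polynomial (λ x m → F x m ℚ.* G x m)
  convert : ∀ {F G} → (∀ x m → F x m ≡ G x m) → Polynomial F → Polynomial G

-- All `d` at once, because multiplication by x turns the moment of order d + 1 into the one of
-- order d.
Moments : (ℝ → ℕ → ℚ) → Set
Moments F = ∀ d → ∃ λ I → HasIntegral (λ x m → F x m ℚ.* seq x m ^ d) I

moments-cong : ∀ F G → (∀ x m → F x m ≡ G x m) → Moments F → Moments G
moments-cong F G F≡G moments d =
  let I , has = moments d
  in I , HasIntegral-cong (λ x m → F x m ℚ.* seq x m ^ d) (λ x m → G x m ℚ.* seq x m ^ d)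
           (λ x m → cong (ℚ._* seq x m ^ d) (F≡G x m)) has

-- The factor `G` is arbitrary so that a product F F′ can be absorbed one factor at a time, first F′
-- into `G` and then F into F′ G.
*-moments : ∀ {F} → Polynomial F → ∀ G → Moments G → Moments (λ x m → F x m ℚ.* G x m)
*-moments (const a) G moments d =
  let I , has = moments d
  in a *ᵣ I , HasIntegral-cong (λ x m → seq a m ℚ.* (G x m ℚ.* seq x m ^ d)) (λ x m → seq a m ℚ.* G x m ℚ.* seq x m ^ d)
       (λ x m → sym (ℚ.*-assoc (seq a m) (G x m) (seq x m ^ d)))
       (HasIntegral-* a (λ x m → G x m ℚ.* seq x m ^ d) I has)
*-moments var G moments d =
  let I , has = moments (suc d)
  in I , HasIntegral-cong (λ x m → G x m ℚ.* seq x m ^ suc d) (λ x m → seq x m ℚ.* G x m ℚ.* seq x m ^ d)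
       (λ x m → exchange (seq x m) (G x m) (seq x m ^ d)) has
  where
  exchange : ∀ a b c → b ℚ.* (a ℚ.* c) ≡ a ℚ.* b ℚ.* c
  exchange = solve 3 (λ a b c → b :* (a :* c) := a :* b :* c) refl
    where open +-*-Solver
*-moments (add {F} {F′} p q) G moments d =
  let I , has = *-moments p G moments d
      J , has′ = *-moments q G moments d
  in I +ᵣ J , HasIntegral-cong
       (λ x m → F x m ℚ.* G x m ℚ.* seq x m ^ d ℚ.+ F′ x m ℚ.* G x m ℚ.* seq x m ^ d)
       (λ x m → (F x m ℚ.+ F′ x m) ℚ.* G x m ℚ.* seq x m ^ d)
       (λ x m → distrib (F x m) (F′ x m) (G x m) (seq x m ^ d))
       (HasIntegral-+ (λ x m → F x m ℚ.* G x m ℚ.* seq x m ^ d) (λ x m → F′ x m ℚ.* G x m ℚ.* seq x m ^ d) I J has has′)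
  where
  distrib : ∀ a b c p → a ℚ.* c ℚ.* p ℚ.+ b ℚ.* c ℚ.* p ≡ (a ℚ.+ b) ℚ.* c ℚ.* p
  distrib = solve 4 (λ a b c p → a :* c :* p :+ b :* c :* p := (a :+ b) :* c :* p) refl
    where open +-*-Solver
*-moments (mul {F} {F′} p q) G moments = moments-cong
  (λ x m → F x m ℚ.* (F′ x m ℚ.* G x m)) (λ x m → F x m ℚ.* F′ x m ℚ.* G x m)
  (λ x m → sym (ℚ.*-assoc (F x m) (F′ x m) (G x m)))
  (*-moments p (λ x m → F′ x m ℚ.* G x m) (*-moments q G moments))
*-moments (convert {F} {F′} F≡F′ p) G moments = moments-cong
  (λ x m → F x m ℚ.* G x m) (λ x m → F′ x m ℚ.* G x m)
  (λ x m → cong (ℚ._* G x m) (F≡F′ x m)) (*-moments p G moments)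

polynomial-integral : ∀ {F} → Polynomial F → ∃ λ I → HasIntegral F I
polynomial-integral {F} p =
  let I , has = *-moments p (λ _ _ → 1ℚ) unit 0
  in I , HasIntegral-cong (λ x m → F x m ℚ.* 1ℚ ℚ.* 1ℚ) F
       (λ x m → trans (ℚ.*-identityʳ (F x m ℚ.* 1ℚ)) (ℚ.*-identityʳ (F x m))) has
  where
  unit : Moments (λ _ _ → 1ℚ)
  unit d = fromℚᵣ (+ 1 / suc d) ,
    HasIntegral-cong (λ x m → seq x m ^ d) (λ x m → 1ℚ ℚ.* seq x m ^ d)
      (λ x m → sym (ℚ.*-identityˡ (seq x m ^ d))) (HasIntegral-^ d)

-- Real and imaginary parts of the complex polynomials

re-* : ∀ z w m → seq (re (z * w)) m ≡ seq (re z) m ℚ.* seq (re w) m ℚ.- seq (im z) m ℚ.* seq (im w) m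
re-* z w m = refl

im-* : ∀ z w m → seq (im (z * w)) m ≡ seq (re z) m ℚ.* seq (im w) m ℚ.+ seq (im z) m ℚ.* seq (re w) m
im-* z w m = refl

re-*-real : ∀ z w m p → seq (re w) m ≡ p → seq (im w) m ≡ 0ℚ → seq (re (z * w)) m ≡ seq (re z) m ℚ.* p
re-*-real z w m p re≡ im≡ = trans (re-* z w m) (simplify (seq (re z) m) (seq (im z) m) _ _ re≡ im≡)
  where
  simplify : ∀ a b P Q → P ≡ p → Q ≡ 0ℚ → a ℚ.* P ℚ.- b ℚ.* Q ≡ a ℚ.* p
  simplify a b P Q refl refl = solve 3 (λ a b p → a :* p :- b :* con 0ℚ := a :* p) refl a b p
    where open +-*-Solver

im-*-real : ∀ z w m p → seq (re w) m ≡ p → seq (im w) m ≡ 0ℚ → seq (im (z * w)) m ≡ seq (im z) m ℚ.* p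
im-*-real z w m p re≡ im≡ = trans (im-* z w m) (simplify (seq (re z) m) (seq (im z) m) _ _ re≡ im≡)
  where
  simplify : ∀ a b P Q → P ≡ p → Q ≡ 0ℚ → a ℚ.* Q ℚ.+ b ℚ.* P ≡ b ℚ.* p
  simplify a b P Q refl refl = solve 3 (λ a b p → a :* con 0ℚ :+ b :* p := b :* p) refl a b p
    where open +-*-Solver

fromℝ-^ : ∀ x k m → seq (re (fromℝ x ^ᶜ k)) m ≡ seq x m ^ k × seq (im (fromℝ x ^ᶜ k)) m ≡ 0ℚ
fromℝ-^ x zero m = refl , refl
fromℝ-^ x (suc k) m =
  let re≡ , im≡ = fromℝ-^ x k m
  in re-*-real (fromℝ x) (fromℝ x ^ᶜ k) m (seq x m ^ k) re≡ im≡ ,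
     trans (im-*-real (fromℝ x) (fromℝ x ^ᶜ k) m (seq x m ^ k) re≡ im≡) (ℚ.*-zeroˡ (seq x m ^ k))

-- With the summands of extend named, Agda does not compare unfolded complex numbers.
initial : (ℕ → ℂ) → ℕ → ℝ → ℂ
initial c n x = sumᶜ {suc n} (λ k → c (toℕ k) * (fromℝ x ^ᶜ toℕ k))

monomial : ℂ → ℕ → ℝ → ℂ
monomial z k x = z * (fromℝ x ^ᶜ k)

re-sumᶜ : ∀ {n} (t : Fin n → ℂ) m → seq (re (sumᶜ t)) m ≡ sum (λ k → seq (re (t k)) m)
re-sumᶜ {zero} t m = refl
re-sumᶜ {suc n} t m = cong (seq (re (t Fin.zero)) m ℚ.+_) (re-sumᶜ (t ∘ Fin.suc) m)

im-sumᶜ : ∀ {n} (t : Fin n → ℂ) m → seq (im (sumᶜ t)) m ≡ sum (λ k → seq (im (t k)) m)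
im-sumᶜ {zero} t m = refl
im-sumᶜ {suc n} t m = cong (seq (im (t Fin.zero)) m ℚ.+_) (im-sumᶜ (t ∘ Fin.suc) m)

re-monomial : ∀ z k x m → seq (re (monomial z k x)) m ≡ seq (re z) m ℚ.* seq x m ^ k
re-monomial z k x m =
  re-*-real z (fromℝ x ^ᶜ k) m (seq x m ^ k) (proj₁ (fromℝ-^ x k m)) (proj₂ (fromℝ-^ x k m))

im-monomial : ∀ z k x m → seq (im (monomial z k x)) m ≡ seq (im z) m ℚ.* seq x m ^ k
im-monomial z k x m =
  im-*-real z (fromℝ x ^ᶜ k) m (seq x m ^ k) (proj₁ (fromℝ-^ x k m)) (proj₂ (fromℝ-^ x k m))

-- Since x is real, the real and imaginary parts of the complex polynomial are real polynomials in
-- the respective parts of its coefficients; this form serves both.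
evaluate : (ℕ → ℝ) → ℕ → ℝ → ℝ → ℕ → ℚ
evaluate α n ζ x m =
  sum {suc n} (λ k → seq (α (toℕ k)) m ℚ.* seq x m ^ toℕ k) ℚ.+ seq ζ m ℚ.* seq x m ^ suc n

re-extend : ∀ c n z x m → seq (re (extend c n z x)) m ≡ evaluate (re ∘ c) n (re z) x m
re-extend c n z x m = trans split (cong₂ ℚ._+_
    (trans (re-initial x) (sum-cong-≗ {suc n} (λ k → re-monomial (c (toℕ k)) (toℕ k) x m)))
    (re-monomial z (suc n) x m))
  where
  split : seq (re (extend c n z x)) m ≡ seq (re (initial c n x)) m ℚ.+ seq (re (monomial z (suc n) x)) m
  split = refl
  re-initial : ∀ x → seq (re (initial c n x)) m ≡ sum {suc n} (λ k → seq (re (monomial (c (toℕ k)) (toℕ k) x)) m)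
  re-initial x = re-sumᶜ {suc n} (λ k → monomial (c (toℕ k)) (toℕ k) x) m

im-extend : ∀ c n z x m → seq (im (extend c n z x)) m ≡ evaluate (im ∘ c) n (im z) x m
im-extend c n z x m = trans split (cong₂ ℚ._+_
    (trans (im-initial x) (sum-cong-≗ {suc n} (λ k → im-monomial (c (toℕ k)) (toℕ k) x m)))
    (im-monomial z (suc n) x m))
  where
  split : seq (im (extend c n z x)) m ≡ seq (im (initial c n x)) m ℚ.+ seq (im (monomial z (suc n) x)) m
  split = refl
  im-initial : ∀ x → seq (im (initial c n x)) m ≡ sum {suc n} (λ k → seq (im (monomial (c (toℕ k)) (toℕ k) x)) m)
  im-initial x = im-sumᶜ {suc n} (λ k → monomial (c (toℕ k)) (toℕ k) x) m

norm² : (ℕ → ℂ) → ℕ → ℂ → ℝ → ℕ → ℚ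
norm² c n z x m =
  evaluate (re ∘ c) n (re z) x m ℚ.* evaluate (re ∘ c) n (re z) x m ℚ.+
  evaluate (im ∘ c) n (im z) x m ℚ.* evaluate (im ∘ c) n (im z) x m

seq-∣∣² : ∀ z m → seq ∣ z ∣² m ≡ seq (re z) m ℚ.* seq (re z) m ℚ.+ seq (im z) m ℚ.* seq (im z) m
seq-∣∣² z m = refl

norm²-extend : ∀ c n z x m → norm² c n z x m ≡ seq ∣ extend c n z x ∣² m
norm²-extend c n z x m = sym (trans (seq-∣∣² (extend c n z x) m)
  (cong₂ (λ p q → p ℚ.* p ℚ.+ q ℚ.* q) (re-extend c n z x m) (im-extend c n z x m)))

power-polynomial : ∀ k → Polynomial (λ x m → seq x m ^ k)
power-polynomial zero = const (fromℚᵣ 1ℚ)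
power-polynomial (suc k) = mul var (power-polynomial k)

sum-polynomial : ∀ n (F : Fin n → ℝ → ℕ → ℚ) → (∀ k → Polynomial (F k)) → Polynomial (λ x m → sum (λ k → F k x m))
sum-polynomial zero F p = const (fromℚᵣ 0ℚ)
sum-polynomial (suc n) F p = add (p Fin.zero) (sum-polynomial n (F ∘ Fin.suc) (p ∘ Fin.suc))

evaluate-polynomial : ∀ α n ζ → Polynomial (evaluate α n ζ)
evaluate-polynomial α n ζ = add
  (sum-polynomial (suc n) (λ k x m → seq (α (toℕ k)) m ℚ.* seq x m ^ toℕ k)
    (λ k → mul (const (α (toℕ k))) (power-polynomial (toℕ k))))
  (mul (const ζ) (power-polynomial (suc n)))

-- Existence is all that is wanted: the value cancels in `minimal⇒≈`.
norm²-integral : ∀ c n z → ∃ λ J → HasIntegral (norm² c n z) J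
norm²-integral c n z =
  let p = evaluate-polynomial (re ∘ c) n (re z)
      q = evaluate-polynomial (im ∘ c) n (im z)
  in polynomial-integral (add (mul p p) (mul q q))

-- Moments with rational values

term-moment : ∀ ζ u → ζ ≈ᵣ fromℚᵣ u → ∀ k d →
  HasIntegral (λ x m → seq ζ m ℚ.* seq x m ^ k ℚ.* seq x m ^ d) (fromℚᵣ (u ℚ.* (+ 1 / suc (k ℕ.+ d))))
term-moment ζ u ζ≈u k d =
  HasIntegral-≈ (λ x m → seq ζ m ℚ.* seq x m ^ k ℚ.* seq x m ^ d) (ζ *ᵣ fromℚᵣ w) (fromℚᵣ (u ℚ.* w))
    (≈ᵣ-*-fromℚᵣ ζ u w ζ≈u)
    (HasIntegral-cong (λ x m → seq ζ m ℚ.* seq x m ^ (k ℕ.+ d)) (λ x m → seq ζ m ℚ.* seq x m ^ k ℚ.* seq x m ^ d)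
      (λ x m → trans (cong (seq ζ m ℚ.*_) (^-homo-* (seq x m) k d))
                     (sym (ℚ.*-assoc (seq ζ m) (seq x m ^ k) (seq x m ^ d))))
      (HasIntegral-* ζ (λ x m → seq x m ^ (k ℕ.+ d)) (fromℚᵣ w) (HasIntegral-^ (k ℕ.+ d))))
  where w = + 1 / suc (k ℕ.+ d)

+-moment : ∀ (F G : ℝ → ℕ → ℚ) d u v →
  HasIntegral (λ x m → F x m ℚ.* seq x m ^ d) (fromℚᵣ u) →
  HasIntegral (λ x m → G x m ℚ.* seq x m ^ d) (fromℚᵣ v) →
  HasIntegral (λ x m → (F x m ℚ.+ G x m) ℚ.* seq x m ^ d) (fromℚᵣ (u ℚ.+ v))
+-moment F G d u v has has′ =
  HasIntegral-≈ (λ x m → (F x m ℚ.+ G x m) ℚ.* seq x m ^ d) (fromℚᵣ u +ᵣ fromℚᵣ v) (fromℚᵣ (u ℚ.+ v))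
    (≐⇒≈ᵣ (fromℚᵣ u +ᵣ fromℚᵣ v) (fromℚᵣ (u ℚ.+ v)) (λ _ → refl))
    (HasIntegral-cong
      (λ x m → F x m ℚ.* seq x m ^ d ℚ.+ G x m ℚ.* seq x m ^ d) (λ x m → (F x m ℚ.+ G x m) ℚ.* seq x m ^ d)
      (λ x m → sym (ℚ.*-distribʳ-+ (seq x m ^ d) (F x m) (G x m)))
      (HasIntegral-+ (λ x m → F x m ℚ.* seq x m ^ d) (λ x m → G x m ℚ.* seq x m ^ d) (fromℚᵣ u) (fromℚᵣ v) has has′))

sum-moment : ∀ n (F : Fin n → ℝ → ℕ → ℚ) (u : Fin n → ℚ) d →
  (∀ k → HasIntegral (λ x m → F k x m ℚ.* seq x m ^ d) (fromℚᵣ (u k))) →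
  HasIntegral (λ x m → sum (λ k → F k x m) ℚ.* seq x m ^ d) (fromℚᵣ (sum u))
sum-moment zero F u d has =
  HasIntegral-≈ (λ x m → 0ℚ ℚ.* seq x m ^ d) (fromℚᵣ 0ℚ *ᵣ fromℚᵣ w) (fromℚᵣ 0ℚ)
    (≐⇒≈ᵣ (fromℚᵣ 0ℚ *ᵣ fromℚᵣ w) (fromℚᵣ 0ℚ) (λ _ → ℚ.*-zeroˡ w))
    (HasIntegral-* (fromℚᵣ 0ℚ) (λ x m → seq x m ^ d) (fromℚᵣ w) (HasIntegral-^ d))
  where w = + 1 / suc d
sum-moment (suc n) F u d has =
  +-moment (F Fin.zero) (λ x m → sum (λ k → F (Fin.suc k) x m)) d (u Fin.zero) (sum (u ∘ Fin.suc))
    (has Fin.zero) (sum-moment n (F ∘ Fin.suc) (u ∘ Fin.suc) d (has ∘ Fin.suc))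

-- The moment depends on the coefficients only up to `_≈ᵣ_`, so an exact identity between their
-- rational values gives orthogonality to xⁿ⁺¹.
evaluate-moment : ∀ α n ζ (u : Fin (suc n) → ℚ) v →
  (∀ k → α (toℕ k) ≈ᵣ fromℚᵣ (u k)) → ζ ≈ᵣ fromℚᵣ v →
  sum (λ k → u k ℚ.* (+ 1 / suc (toℕ k ℕ.+ suc n))) ℚ.+ v ℚ.* (+ 1 / suc (suc n ℕ.+ suc n)) ≡ 0ℚ →
  HasIntegral (λ x m → evaluate α n ζ x m ℚ.* seq x m ^ suc n) (fromℚᵣ 0ℚ)
evaluate-moment α n ζ u v α≈u ζ≈v vanishes =
  subst (λ I → HasIntegral (λ x m → evaluate α n ζ x m ℚ.* seq x m ^ suc n) (fromℚᵣ I)) vanishes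
    (+-moment (λ x m → sum {suc n} (λ k → seq (α (toℕ k)) m ℚ.* seq x m ^ toℕ k)) (λ x m → seq ζ m ℚ.* seq x m ^ suc n) (suc n)
      (sum (λ k → u k ℚ.* (+ 1 / suc (toℕ k ℕ.+ suc n)))) (v ℚ.* (+ 1 / suc (suc n ℕ.+ suc n)))
      (sum-moment (suc n) (λ k x m → seq (α (toℕ k)) m ℚ.* seq x m ^ toℕ k) (λ k → u k ℚ.* (+ 1 / suc (toℕ k ℕ.+ suc n))) (suc n)
        (λ k → term-moment (α (toℕ k)) (u k) (α≈u k) (toℕ k) (suc n)))
      (term-moment ζ v ζ≈v (suc n) (suc n)))

-- The greedy sequence

-- Stands in for a square root: δ < |a| would give δ² < a² ≤ a² + c².
square-bound : ∀ a c {δ} → 0ℚ ℚ.< δ → a ℚ.* a ℚ.+ c ℚ.* c ℚ.≤ δ ℚ.* δ → ℚ.∣ a ∣ ℚ.≤ δ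
square-bound a c {δ} 0<δ le with ℚ.∣ a ∣ ℚ.≤? δ
... | yes ∣a∣≤δ = ∣a∣≤δ
... | no ∣a∣≰δ = contradiction (ℚ.<-≤-trans (begin-strict
  δ ℚ.* δ                    <⟨ ℚ.*-monoʳ-<-pos δ {{ℚ.positive 0<δ}} δ<∣a∣ ⟩
  δ ℚ.* ℚ.∣ a ∣              <⟨ ℚ.*-monoˡ-<-pos ℚ.∣ a ∣ {{ℚ.positive (ℚ.<-trans 0<δ δ<∣a∣)}} δ<∣a∣ ⟩
  ℚ.∣ a ∣ ℚ.* ℚ.∣ a ∣        ≡⟨ ∣p∣*∣p∣≡p*p a ⟩
  a ℚ.* a                    ≡⟨ ℚ.+-identityʳ (a ℚ.* a) ⟨
  a ℚ.* a ℚ.+ 0ℚ             ≤⟨ ℚ.+-monoʳ-≤ (a ℚ.* a) (0≤p*p c) ⟩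
  a ℚ.* a ℚ.+ c ℚ.* c        ∎) le) (ℚ.<-irrefl refl)
  where
  open ℚ.≤-Reasoning
  δ<∣a∣ = ℚ.≰⇒> ∣a∣≰δ
  ∣p∣*∣p∣≡p*p : ∀ p → ℚ.∣ p ∣ ℚ.* ℚ.∣ p ∣ ≡ p ℚ.* p
  ∣p∣*∣p∣≡p*p p with ℚ.∣p∣≡p∨∣p∣≡-p p
  ... | inj₁ eq rewrite eq = refl
  ... | inj₂ eq rewrite eq = solve 1 (λ p → :- p :* :- p := p :* p) refl p
    where open +-*-Solver
  0≤p*p : ∀ p → 0ℚ ℚ.≤ p ℚ.* p
  0≤p*p p = subst (0ℚ ℚ.≤_) (∣p∣*∣p∣≡p*p p)
    (ℚ.nonNegative⁻¹ _ {{ℚ.nonNeg*nonNeg⇒nonNeg ℚ.∣ p ∣ {{ℚ.∣-∣-nonNeg p}} ℚ.∣ p ∣ {{ℚ.∣-∣-nonNeg p}}}})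

evaluate-shift : ∀ α n ζ ζ′ x m →
  evaluate α n ζ′ x m ≡ evaluate α n ζ x m ℚ.+ (seq ζ′ m ℚ.- seq ζ m) ℚ.* seq x m ^ suc n
evaluate-shift α n ζ ζ′ x m =
  shift (sum {suc n} (λ k → seq (α (toℕ k)) m ℚ.* seq x m ^ toℕ k)) (seq ζ m) (seq ζ′ m) (seq x m ^ suc n)
  where
  shift : ∀ s a b p → s ℚ.+ b ℚ.* p ≡ s ℚ.+ a ℚ.* p ℚ.+ (b ℚ.- a) ℚ.* p
  shift = solve 4 (λ s a b p → s :+ b :* p := s :+ a :* p :+ (b :- a) :* p) refl
    where open +-*-Solver

-- This is |h + wp|² with h = e + if and w = a + ib. The left side is grouped into summands to be
-- integrated separately: |h|², two cross terms that orthogonality annihilates, and |w|² p².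
square-expansion : ∀ e f a b p →
  e ℚ.* e ℚ.+ f ℚ.* f ℚ.+
    ((+ 2 / 1) ℚ.* a ℚ.* (e ℚ.* p) ℚ.+ ((+ 2 / 1) ℚ.* b ℚ.* (f ℚ.* p) ℚ.+ (a ℚ.* a ℚ.+ b ℚ.* b) ℚ.* (p ℚ.* p)))
  ≡ (e ℚ.+ a ℚ.* p) ℚ.* (e ℚ.+ a ℚ.* p) ℚ.+ (f ℚ.+ b ℚ.* p) ℚ.* (f ℚ.+ b ℚ.* p)
square-expansion = solve 5 (λ e f a b p →
  e :* e :+ f :* f :+
    (con (+ 2 / 1) :* a :* (e :* p) :+ (con (+ 2 / 1) :* b :* (f :* p) :+ (a :* a :+ b :* b) :* (p :* p)))
  := (e :+ a :* p) :* (e :+ a :* p) :+ (f :+ b :* p) :* (f :+ b :* p)) refl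
  where open +-*-Solver

-- If z makes the polynomial orthogonal to xⁿ⁺¹, then replacing z by z′ increases
-- its squared norm by |z′ − z|² / (2n+3).
minimal⇒≈ : ∀ c n z z′ →
  HasIntegral (λ x m → evaluate (re ∘ c) n (re z) x m ℚ.* seq x m ^ suc n) (fromℚᵣ 0ℚ) →
  HasIntegral (λ x m → evaluate (im ∘ c) n (im z) x m ℚ.* seq x m ^ suc n) (fromℚᵣ 0ℚ) →
  ‖ extend c n z′ ‖≤‖ extend c n z ‖ → z′ ≈ z
minimal⇒≈ c n z z′ orthogonalᵣ orthogonalᵢ minimal =
  (λ δ 0<δ → let M , small = bounded δ 0<δ in M , λ m M≤m →
    square-bound (seq dr m) (seq di m) 0<δ (small m M≤m)) ,
  (λ δ 0<δ → let M , small = bounded δ 0<δ in M , λ m M≤m →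
    square-bound (seq di m) (seq dr m) 0<δ
      (subst (ℚ._≤ δ ℚ.* δ) (ℚ.+-comm (seq dr m ℚ.* seq dr m) (seq di m ℚ.* seq di m)) (small m M≤m)))
  where
  N = suc n
  -- The squared norm 1 / (2n + 3) of xⁿ⁺¹.
  κ = + 1 / suc (N ℕ.+ N)
  dr di 2dr 2di squares 0ᵣ J I : ℝ
  dr = re z′ -ᵣ re z
  di = im z′ -ᵣ im z
  2dr = fromℚᵣ (+ 2 / 1) *ᵣ dr
  2di = fromℚᵣ (+ 2 / 1) *ᵣ di
  squares = dr *ᵣ dr +ᵣ di *ᵣ di
  0ᵣ = fromℚᵣ 0ℚ
  J = proj₁ (norm²-integral c n z)
  -- The integrals of the summands of `square-expansion`, in the same grouping; both cross terms are
  -- multiples of the zero moment.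
  I = J +ᵣ (2dr *ᵣ 0ᵣ +ᵣ (2di *ᵣ 0ᵣ +ᵣ squares *ᵣ fromℚᵣ κ))

  E F crossᵣ crossᵢ last : ℝ → ℕ → ℚ
  E = evaluate (re ∘ c) n (re z)
  F = evaluate (im ∘ c) n (im z)
  crossᵣ x m = seq 2dr m ℚ.* (E x m ℚ.* seq x m ^ N)
  crossᵢ x m = seq 2di m ℚ.* (F x m ℚ.* seq x m ^ N)
  last x m = seq squares m ℚ.* seq x m ^ (N ℕ.+ N)

  expansion : ∀ x m →
    norm² c n z x m ℚ.+ (crossᵣ x m ℚ.+ (crossᵢ x m ℚ.+ last x m)) ≡ seq ∣ extend c n z′ x ∣² m
  expansion x m = begin
    norm² c n z x m ℚ.+ (crossᵣ x m ℚ.+ (crossᵢ x m ℚ.+ last x m))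
      ≡⟨ cong (λ t → norm² c n z x m ℚ.+ (crossᵣ x m ℚ.+ (crossᵢ x m ℚ.+ seq squares m ℚ.* t)))
           (^-homo-* (seq x m) N N) ⟩
    norm² c n z x m ℚ.+ (crossᵣ x m ℚ.+ (crossᵢ x m ℚ.+ seq squares m ℚ.* (p ℚ.* p)))
      ≡⟨ square-expansion (E x m) (F x m) (seq dr m) (seq di m) p ⟩
    (E x m ℚ.+ seq dr m ℚ.* p) ℚ.* (E x m ℚ.+ seq dr m ℚ.* p) ℚ.+ (F x m ℚ.+ seq di m ℚ.* p) ℚ.* (F x m ℚ.+ seq di m ℚ.* p)
      ≡⟨ cong₂ (λ s t → s ℚ.* s ℚ.+ t ℚ.* t) (evaluate-shift (re ∘ c) n (re z) (re z′) x m)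
           (evaluate-shift (im ∘ c) n (im z) (im z′) x m) ⟨
    norm² c n z′ x m
      ≡⟨ norm²-extend c n z′ x m ⟩
    seq ∣ extend c n z′ x ∣² m ∎
    where
    open ≡-Reasoning
    p = seq x m ^ N

  hasJ : HasIntegral (λ x m → seq ∣ extend c n z x ∣² m) J
  hasJ = HasIntegral-cong (norm² c n z) (λ x m → seq ∣ extend c n z x ∣² m) (norm²-extend c n z)
    (proj₂ (norm²-integral c n z))

  hasI : HasIntegral (λ x m → seq ∣ extend c n z′ x ∣² m) I
  hasI = HasIntegral-cong (λ x m → norm² c n z x m ℚ.+ (crossᵣ x m ℚ.+ (crossᵢ x m ℚ.+ last x m)))
    (λ x m → seq ∣ extend c n z′ x ∣² m) expansion
    (HasIntegral-+ (norm² c n z) (λ x m → crossᵣ x m ℚ.+ (crossᵢ x m ℚ.+ last x m))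
      J (2dr *ᵣ 0ᵣ +ᵣ (2di *ᵣ 0ᵣ +ᵣ squares *ᵣ fromℚᵣ κ)) (proj₂ (norm²-integral c n z))
      (HasIntegral-+ crossᵣ (λ x m → crossᵢ x m ℚ.+ last x m) (2dr *ᵣ 0ᵣ) (2di *ᵣ 0ᵣ +ᵣ squares *ᵣ fromℚᵣ κ)
        (HasIntegral-* 2dr (λ x m → E x m ℚ.* seq x m ^ N) 0ᵣ orthogonalᵣ)
        (HasIntegral-+ crossᵢ last (2di *ᵣ 0ᵣ) (squares *ᵣ fromℚᵣ κ)
          (HasIntegral-* 2di (λ x m → F x m ℚ.* seq x m ^ N) 0ᵣ orthogonalᵢ)
          (HasIntegral-* squares (λ x m → seq x m ^ (N ℕ.+ N)) (fromℚᵣ κ) (HasIntegral-^ (N ℕ.+ N))))))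

  I≤J : I ≤ᵣ J
  I≤J = minimal I J (HasIntegral⇒Integral₀¹ (λ x → ∣ extend c n z′ x ∣²) hasI)
                    (HasIntegral⇒Integral₀¹ (λ x → ∣ extend c n z x ∣²) hasJ)

  κ>0 : ℚ.Positive κ
  κ>0 = ℚ.normalize-pos 1 (suc (N ℕ.+ N))

  cancel : ∀ j a c s κ ε → j ℚ.+ (a ℚ.* 0ℚ ℚ.+ (c ℚ.* 0ℚ ℚ.+ s ℚ.* κ)) ℚ.≤ j ℚ.+ ε → s ℚ.* κ ℚ.≤ ε
  cancel j a c s κ ε le = subst₂ ℚ._≤_ (left j a c s κ) (right j ε) (ℚ.+-monoʳ-≤ (ℚ.- j) le)
    where
    open +-*-Solver
    left : ∀ j a c s κ → ℚ.- j ℚ.+ (j ℚ.+ (a ℚ.* 0ℚ ℚ.+ (c ℚ.* 0ℚ ℚ.+ s ℚ.* κ))) ≡ s ℚ.* κ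
    left = solve 5 (λ j a c s κ → :- j :+ (j :+ (a :* con 0ℚ :+ (c :* con 0ℚ :+ s :* κ))) := s :* κ) refl
    right : ∀ j ε → ℚ.- j ℚ.+ (j ℚ.+ ε) ≡ ε
    right = solve 2 (λ j ε → :- j :+ (j :+ ε) := ε) refl

  bounded : ∀ δ → 0ℚ ℚ.< δ → ∃ λ M → ∀ m → M ℕ.≤ m →
    seq dr m ℚ.* seq dr m ℚ.+ seq di m ℚ.* seq di m ℚ.≤ δ ℚ.* δ
  bounded δ 0<δ =
    -- The tolerance δ²κ is chosen so that cancelling `J` and then `κ` leaves |z′ - z|² ≤ δ².
    let M , le = I≤J (δ ℚ.* δ ℚ.* κ) 0<δδκ
    in M , λ m M≤m → ℚ.*-cancelʳ-≤-pos κ {{κ>0}}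
      (cancel (seq J m) (seq 2dr m) (seq 2di m) (seq squares m) κ (δ ℚ.* δ ℚ.* κ) (le m M≤m))
    where
    δ>0 : ℚ.Positive δ
    δ>0 = ℚ.positive 0<δ
    0<δδκ : 0ℚ ℚ.< δ ℚ.* δ ℚ.* κ
    0<δδκ = ℚ.positive⁻¹ (δ ℚ.* δ ℚ.* κ)
      {{ℚ.pos*pos⇒pos (δ ℚ.* δ) {{ℚ.pos*pos⇒pos δ {{δ>0}} δ {{δ>0}}}} κ {{κ>0}}}}

-- If u ≠ 0, the tolerance ½|u| would force |u| ≤ ½|u|.
fromℚᵣ-≈0 : ∀ u → fromℚᵣ u ≈ᵣ fromℚᵣ 0ℚ → u ≡ 0ℚ
fromℚᵣ-≈0 u u≈0 with u ℚ.≟ 0ℚ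
... | yes u≡0 = u≡0
... | no u≢0 = contradiction
  (ℚ.<-≤-trans ½∣u∣<∣u∣
    (subst (λ p → ℚ.∣ p ∣ ℚ.≤ ½ ℚ.* ℚ.∣ u ∣) (ℚ.+-identityʳ u) (proj₂ (u≈0 _ (0<½* 0<∣u∣)) _ ℕ.≤-refl)))
  (ℚ.<-irrefl refl)
  where
  0<∣u∣ : 0ℚ ℚ.< ℚ.∣ u ∣
  0<∣u∣ = ℚ.≰⇒> λ ∣u∣≤0 → u≢0 (ℚ.∣p∣≡0⇒p≡0 u (ℚ.≤-antisym ∣u∣≤0 (ℚ.0≤∣p∣ u)))
  ½∣u∣<∣u∣ : ½ ℚ.* ℚ.∣ u ∣ ℚ.< ℚ.∣ u ∣
  ½∣u∣<∣u∣ = subst₂ ℚ._<_ (ℚ.+-identityʳ (½ ℚ.* ℚ.∣ u ∣)) (½+½ ℚ.∣ u ∣)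
    (ℚ.+-monoʳ-< (½ ℚ.* ℚ.∣ u ∣) (0<½* 0<∣u∣))

sum-0* : ∀ {n} (w : Fin n → ℚ) → sum (λ k → 0ℚ ℚ.* w k) ≡ 0ℚ
sum-0* w = trans (sym (*-distribˡ-sum 0ℚ w)) (ℚ.*-zeroˡ (sum w))

Coefficient : (ℕ → ℂ) → ℕ → Set
Coefficient c n = ∃ λ e → 2 ∤ ℤ.∣ e ∣ × c n ≈ fromℚ (e /[2 n ]!)

-- Minimality is tested against a single competitor, the rational value `v` that achieves
-- orthogonality.
greedy-step : ∀ c → IsGreedy c → ∀ n → (∀ k → k ℕ.< suc n → Coefficient c k) → Coefficient c (suc n)
greedy-step c greedy n previous =
  let e′ , 2∤e′ , vanishes = next-coefficient n e 2∤e
      v = e′ /[2 suc n ]!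
  in e′ , 2∤e′ , minimal⇒≈ c n (fromℚ v) (c (suc n))
       (evaluate-moment (re ∘ c) n (fromℚᵣ v) (λ k → e k /[2 toℕ k ]!) v
         (λ k → proj₁ (c≈ k)) (≐⇒≈ᵣ (fromℚᵣ v) (fromℚᵣ v) (λ _ → refl)) vanishes)
       -- The earlier coefficients have imaginary parts equal to 0 up to `_≈ᵣ_`, so the imaginary
       -- part is orthogonal to xⁿ⁺¹ with all rational values 0.
       (evaluate-moment (im ∘ c) n (fromℚᵣ 0ℚ) (λ _ → 0ℚ) 0ℚ
         (λ k → proj₂ (c≈ k)) (≐⇒≈ᵣ (fromℚᵣ 0ℚ) (fromℚᵣ 0ℚ) (λ _ → refl)) zeros)
       (proj₂ greedy n (fromℚ v))
  where
  e : Fin (suc n) → ℤ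
  e k = proj₁ (previous (toℕ k) (Fin.toℕ<n k))
  2∤e : ∀ k → 2 ∤ ℤ.∣ e k ∣
  2∤e k = proj₁ (proj₂ (previous (toℕ k) (Fin.toℕ<n k)))
  c≈ : ∀ k → c (toℕ k) ≈ fromℚ (e k /[2 toℕ k ]!)
  c≈ k = proj₂ (proj₂ (previous (toℕ k) (Fin.toℕ<n k)))
  zeros : sum {suc n} (λ k → 0ℚ ℚ.* (+ 1 / suc (toℕ k ℕ.+ suc n))) ℚ.+ 0ℚ ℚ.* (+ 1 / suc (suc n ℕ.+ suc n)) ≡ 0ℚ
  zeros = cong₂ ℚ._+_ (sum-0* {suc n} (λ k → + 1 / suc (toℕ k ℕ.+ suc n)))
                      (ℚ.*-zeroˡ (+ 1 / suc (suc n ℕ.+ suc n)))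

greedy-coefficient : ∀ c → IsGreedy c → ∀ n → Coefficient c n
greedy-coefficient c greedy = <-rec (Coefficient c) step
  where
  step : ∀ n → (∀ {k} → k ℕ.< n → Coefficient c k) → Coefficient c n
  step zero _ = + 1 , 2∤1+2* 0 , proj₁ greedy
  step (suc n) previous = greedy-step c greedy n (λ k k<1+n → previous k<1+n)

proposition2 : (c : ℕ → ℂ) → IsGreedy c → (n : ℕ) →
    Σ ℚ λ u → (c n ≈ fromℚ u)
    × (∃ λ r → (2 ∤ r) × (↧ₙ u ≡ 2 ℕ.^ (2 ℕ.* n ∸ b n) ℕ.* r))
    × (∣ u ∣₂ ≡ + (2 ℕ.^ (2 ℕ.* n ∸ b n)) / 1)
    × ¬ (c n ≈ 0ℂ)
proposition2 c greedy n = from-decomposition (greedy-coefficient c greedy n) ([2n]!-decomposition n)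
  where
  K = 2 ℕ.* n ∸ b n

  from-decomposition : Coefficient c n → (∃ λ r → 2 ∤ r × (2 ℕ.* n) ! ≡ 2 ℕ.^ K ℕ.* r) →
    Σ ℚ λ u → (c n ≈ fromℚ u)
      × (∃ λ r → (2 ∤ r) × (↧ₙ u ≡ 2 ℕ.^ K ℕ.* r))
      × (∣ u ∣₂ ≡ + (2 ℕ.^ K) / 1)
      × ¬ (c n ≈ 0ℂ)
  from-decomposition (e , 2∤e , c≈u) (R , 2∤R , [2n]!≡) =
    let r , 2∤r , ↧u≡ = ↧ₙ-odd/ e 2∤e K R 2∤R ((2 ℕ.* n) !) {{(2 ℕ.* n) ℕ.!≢0}} [2n]!≡
    in u , c≈u , (r , 2∤r , ↧u≡) , ∣∣₂-≡ u K r u≢0 2∤↥u 2∤r ↧u≡ , λ c≈0 →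
      -- The real parts suffice: u ≈ re (c n) ≈ 0 forces u = 0, although its numerator is odd.
      u≢0 (fromℚᵣ-≈0 u (λ ε 0<ε → close-trans ε (λ _ → u) (seq (re (c n))) (λ _ → 0ℚ)
        (close-sym (½ ℚ.* ε) (seq (re (c n))) (λ _ → u) (proj₁ c≈u (½ ℚ.* ε) (0<½* 0<ε)))
        (proj₁ c≈0 (½ ℚ.* ε) (0<½* 0<ε))))
    where
    u = e /[2 n ]!
    2∤↥u = 2∤↥/ e 2∤e K R 2∤R ((2 ℕ.* n) !) {{(2 ℕ.* n) ℕ.!≢0}} [2n]!≡
    u≢0 = odd/≢0 e 2∤e K R 2∤R ((2 ℕ.* n) !) {{(2 ℕ.* n) ℕ.!≢0}} [2n]!≡
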